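{- Consider CMS-CU with $d$ rows and $w$ counters per row, fed with an IRM request stream, as described in the context. For every item $i\in I$ there exists a constant $B_i\ge 0$ such that for every $t\ge 1$, $$\mathbb{E}\!\left[\frac{e_i(t)}{t}\right]\le \frac{1}{w}\sum_{j\in I\setminus\{i\}}p_j\,\gamma_{i,j}+\frac{B_i}{t},$$ where $$\gamma_{i,j}=\begin{cases}1,& j\le i,\\ \min\big(\mathcal{A}(p_i-p_j)^{d-1},\,1\big),& j>i,\end{cases}$$ with $\mathcal{A}(x)=\min_{k=0,\dots,w-1}\left(\frac{\sum_{l>k}p_l}{(w-k)x}+\frac{k}{w}\right)$ for $x>0$ and $\mathcal{A}(0)=1$.
   Context: Items form the universe $I=\{1,\dots,N\}$. Requests follow the Independent Reference Model (IRM): the stream is $Z(1),Z(2),\dots$ with $Z(s)$ i.i.d. categorical random variables, $\Pr(Z(s)=i)=p_i$, $\sum_{i\in I}p_i=1$, and items are numbered so that $p_1\ge p_2\ge\dots\ge p_N$. The sketch is a $d\times w$ array of counters, initially $0$. Hash functions $h_1,\dots,h_d:I\to\{1,\dots,w\}$ are chosen independently and uniformly at random from a family of pairwise independent hash functions (so $\Pr(h_r(i)=h_r(j))=1/w$ for $i\ne j$), independently of the request stream, and are fixed during processing. $c_i^r(t)$ denotes the value at time $t$ of the counter in row $r$, column $h_r(i)$. CMS-CU update: when item $i$ is requested at time $t$, $c_i^r(t)=\max\big(c_i^r(t-1),\ \min_{f\in[d]}c_i^f(t-1)+1\big)$ for all $r\in[d]$ (other counters unchanged). $n_i(t)$ is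 the number of occurrences of item $i$ among $Z(1),\dots,Z(t)$; the estimate is $\hat n_i(t)=\min_{r\in[d]}c_i^r(t)$ and the estimation error is $e_i(t)=\hat n_i(t)-n_i(t)$. Expectations are taken over both the random choice of hash functions and the request process. -}

module Defs where

open import Algebra.Bundles using (CommutativeRing)
open import Algebra.Core using (Op₁; Op₂)
open import Data.Bool.Base using (if_then_else_)
open import Data.Fin.Base as Fin using (Fin; toℕ)
open import Data.Fin.Properties as Fin using ()
open import Data.Nat.Base as ℕ using (ℕ; zero; suc; _∸_; NonZero)
open import Data.Nat.Properties as ℕ using ()
open import Data.Vec.Base as Vec using (Vec; []; _∷_)
open import Level as Level using ()
open import Relation.Binary.Bundles using (DecTotalOrder)
open import Relation.Binary.Core using (Rel)
open import Relation.Binary.PropositionalEquality.Core using (_≢_)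
open import Relation.Binary.Structures using (IsDecTotalOrder)
open import Relation.Nullary.Decidable using (does; _×-dec_; ¬?)
open import Relation.Nullary.Negation.Core using (¬_)
open import Relation.Unary using (Pred; Decidable)

import Algebra.Construct.NaturalChoice.Min as NaturalMin
import Algebra.Properties.Semiring.Exp as Exp
import Algebra.Properties.Semiring.Mult as Mult
import Algebra.Properties.Semiring.Sum as Sum

-- The scalars.  Every quantity below is a finite expression in the field
-- operations and the order, so the real numbers are used only as an ordered
-- field (with a classically decidable order).  The inverse is total; its value
-- at 0# is unspecified.

record OrderedField c ℓ₁ ℓ₂ : Set (Level.suc (c Level.⊔ ℓ₁ Level.⊔ ℓ₂)) where
  infix 4 _≤_
  infix 8 _⁻¹
  infixl 7 _/_
  field
    commutativeRing : CommutativeRing c ℓ₁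

  open CommutativeRing commutativeRing public

  field
    _⁻¹             : Op₁ Carrier
    _≤_             : Rel Carrier ℓ₂
    0≉1             : ¬ 0# ≈ 1#
    ⁻¹-cong         : ∀ {x y} → x ≈ y → x ⁻¹ ≈ y ⁻¹
    ⁻¹-inverseʳ     : ∀ {x} → ¬ x ≈ 0# → x * x ⁻¹ ≈ 1#
    isDecTotalOrder : IsDecTotalOrder _≈_ _≤_
    +-monoʳ-≤       : ∀ x {y z} → y ≤ z → x + y ≤ x + z
    *-nonNeg        : ∀ {x y} → 0# ≤ x → 0# ≤ y → 0# ≤ x * y

  decTotalOrder : DecTotalOrder c ℓ₁ ℓ₂
  decTotalOrder = record { isDecTotalOrder = isDecTotalOrder }

  open DecTotalOrder decTotalOrder public using (_≟_; _≤?_)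
  open NaturalMin (DecTotalOrder.totalOrder decTotalOrder) public using (_⊓_)
  open Exp semiring public using (_^_)
  open Sum semiring public using (sum)

  _/_ : Op₂ Carrier
  x / y = x * y ⁻¹

  fromℕ : ℕ → Carrier
  fromℕ n = n · 1#
    where open Mult semiring using () renaming (_×_ to _·_)

minimum : ∀ {a} {A : Set a} {n} .{{_ : NonZero n}} → Op₂ A → (Fin n → A) → A
minimum {n = suc n} _∧_ f = Vec.foldr₁ _∧_ (Vec.tabulate f)

module FiniteProbability {c ℓ₁ ℓ₂} (K : OrderedField c ℓ₁ ℓ₂) where
  open OrderedField K

  sumOver : ∀ {n ℓ} {P : Pred (Fin n) ℓ} → Decidable P → (Fin n → Carrier) → Carrier
  sumOver P? f = sum (λ j → if does (P? j) then f j else 0#)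

  record IsDistribution {n} (p : Fin n → Carrier) : Set (ℓ₁ Level.⊔ ℓ₂) where
    field
      nonNeg   : ∀ j → 0# ≤ p j
      sumToOne : sum p ≈ 1#

  uniform : ∀ n → Fin n → Carrier
  uniform n _ = fromℕ n ⁻¹

  Pr : ∀ {n ℓ} {P : Pred (Fin n) ℓ} → (Fin n → Carrier) → Decidable P → Carrier
  Pr p P? = sumOver P? p

  -- Expectation of X(Z(1),…,Z(t)) for Z(s) i.i.d. with law p, i.e. the integral
  -- against the t-fold product measure, one coordinate at a time.
  𝔼-iid : ∀ {n} → (Fin n → Carrier) → ∀ t → (Vec (Fin n) t → Carrier) → Carrier
  𝔼-iid p zero    X = X []
  𝔼-iid p (suc t) X = sum (λ j → p j * 𝔼-iid p t (λ z → X (j ∷ z)))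

  -- A family of M hash functions, drawn from uniformly: for distinct items the
  -- pair of hash values is uniform on [w]².
  PairwiseIndependent : ∀ {M N w} → (Fin M → Fin N → Fin w) → Set ℓ₁
  PairwiseIndependent {M} {N} {w} H = ∀ (i j : Fin N) → i ≢ j → ∀ (a b : Fin w) →
    Pr (uniform M) (λ m → (H m i Fin.≟ a) ×-dec (H m j Fin.≟ b))
      ≈ fromℕ w ⁻¹ * fromℕ w ⁻¹

module CMS-CU {d w N : ℕ} .{{_ : NonZero d}} (h : Fin d → Fin N → Fin w) where

  Sketch : Set
  Sketch = Fin d → Fin w → ℕ

  empty : Sketch
  empty r a = 0

  estimate : Sketch → Fin N → ℕ
  estimate C i = minimum ℕ._⊓_ (λ r → C r (h r i))

  update : Sketch → Fin N → Sketch
  update C i r a =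
    if does (a Fin.≟ h r i) then C r a ℕ.⊔ (estimate C i ℕ.+ 1) else C r a

  process : ∀ {t} → Vec (Fin N) t → Sketch
  process = Vec.foldl′ update empty

  occurrences : ∀ {t} → Vec (Fin N) t → Fin N → ℕ
  occurrences z i = Vec.count (Fin._≟ i) z

module Error {c ℓ₁ ℓ₂} (K : OrderedField c ℓ₁ ℓ₂) where
  open OrderedField K
  open FiniteProbability K

  error : ∀ {d w N t} .{{_ : NonZero d}} →
          (Fin d → Fin N → Fin w) → Vec (Fin N) t → Fin N → Carrier
  error h z i = fromℕ (estimate (process z) i) - fromℕ (occurrences z i)
    where open CMS-CU h

  -- E[e_i(t)/t]: the d rows draw independent uniform members of H, independently
  -- of the stream, whose first t requests are i.i.d. with law p.
  expectedErrorRate : ∀ {M N w} (d : ℕ) .{{_ : NonZero d}} →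
    (Fin M → Fin N → Fin w) → (Fin N → Carrier) → Fin N → ℕ → Carrier
  expectedErrorRate {M} d H p i t =
    𝔼-iid (uniform M) d (λ m →
      𝔼-iid p t (λ z →
        error (λ r → H (Vec.lookup m r)) z i / fromℕ t))

  module _ (d w : ℕ) .{{_ : NonZero w}} {N : ℕ} (p : Fin N → Carrier) where

    -- Items are numbered from 0 here, so the sum over items numbered l > k
    -- from 1 runs over the indices l with k ≤ toℕ l.
    𝒜 : Carrier → Carrier
    𝒜 x = if does (x ≟ 0#) then 1# else minimum {n = w} _⊓_ (λ k →
      sumOver (λ l → toℕ k ℕ.≤? toℕ l) p / (fromℕ (w ∸ toℕ k) * x)
        + fromℕ (toℕ k) / fromℕ w)

    γ : Fin N → Fin N → Carrier
    γ i j = if does (j Fin.≤? i) then 1# else (𝒜 (p i - p j) ^ (d ∸ 1)) ⊓ 1#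

    errorBound : Fin N → Carrier
    errorBound i = fromℕ w ⁻¹ * sumOver (λ j → ¬? (j Fin.≟ i)) (λ j → p j * γ i j)

{-# OPTIONS --safe #-}
module Submission where

open import Data.Bool.Base using (Bool; true; false; not; if_then_else_; _∧_)
open import Data.Empty using (⊥-elim)
open import Data.Fin.Base as Fin using (Fin; zero; suc; toℕ)
open import Data.Fin.Properties as Fin using ()
open import Data.List.Base using (List; []; _∷_)
open import Data.Nat.Base as ℕ using (ℕ; zero; suc; NonZero; z≤n; s≤s; _∸_)
open import Data.Nat.Properties as ℕ using ()
open import Data.Product.Base using (_×_; _,_; ∃-syntax; proj₁)
open import Data.Sum.Base using (_⊎_; inj₁; inj₂)
open import Data.Vec.Base as Vec using (Vec; []; _∷_)
open import Function.Base using (_∘_; flip)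
open import Function.Bundles using (mk⇔)
open import Level as Level using ()
open import Relation.Binary.Bundles using (DecTotalOrder)
open import Relation.Binary.Core using (Rel)
open import Relation.Binary.PropositionalEquality.Core as ≡ using (_≡_; _≢_)
open import Relation.Nullary.Decidable
  using (Dec; yes; no; does; dec-true; dec-false; does-⇔; _×-dec_; ¬?)
open import Relation.Nullary.Negation.Core using (¬_; contradiction)
open import Defs

import Algebra.Construct.NaturalChoice.Min as NaturalMin
import Algebra.Properties.Ring as RingProperties
import Algebra.Properties.Semiring.Mult as Mult
import Algebra.Properties.Semiring.Sum as Sum
import Algebra.Solver.Ring.NaturalCoefficients.Default as SemiringSolver
import Relation.Binary.Construct.NonStrictToStrict as Strict
import Relation.Binary.Reasoning.PartialOrder as PartialOrderReasoning

-- A request of l ≠ i raises the counter of i in the first row only if l collides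
-- with i there and the estimate of l has reached that counter, hence the number
-- n of requests of i.  By then, in each of the other d − 1 rows, the bucket of l
-- has received at least n requests.  If the mass of that bucket is below p i in
-- some row, then n outgrows it: a walk with negative drift is ≥ 0 for a bounded
-- expected time, which only contributes to B.  So all d − 1 buckets may be
-- assumed to have mass at least p i.  By independence of the rows this has
-- probability (1/w) q ^ (d − 1) together with the collision, where q ≤ 1, and for
-- p l ≤ p i also q ≤ 𝒜 (p i − p l)
-- by Markov's inequality.

-- The scalars form an arbitrary ordered field, so the expected time that the walk spends at or
-- above 0 cannot be computed as an infinite sum. Potentials take its place: if a nonnegative
-- function of the history drops in conditional mean by at least the amount paid now, then its
-- initial value bounds the expected total payment up to any time. These initial values are what `B`
-- is made of. Although the estimate is a minimum over all rows, only the counter in the first row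
-- is followed. This divides the hash functions: the collision with i reads the first row, the
-- masses of the buckets read the others, and the expectation over the draws factors. A bucket of
-- mass exactly p i counts as heavy, because a walk without drift has no contracting exponential.

-- Ordered-field arithmetic and finite sums

module OrderedFieldProperties {c ℓ₁ ℓ₂} (K : OrderedField c ℓ₁ ℓ₂) where
  open OrderedField K hiding (zero)
  open DecTotalOrder decTotalOrder public
    using (poset; total; antisym)
    renaming (refl to ≤-refl; reflexive to ≤-reflexive; trans to ≤-trans)
  open Strict _≈_ _≤_ public using (_<_)
  open NaturalMin (DecTotalOrder.totalOrder decTotalOrder) public using (⊓-glb)
  open PartialOrderReasoning poset
  open RingProperties ring using (-‿distribˡ-*; x[y-z]≈xy-xz; -‿involutive)

  ≰⇒> : ∀ {x y} → ¬ x ≤ y → y < x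
  ≰⇒> = Strict.≰⇒> _≈_ _≤_ sym ≤-reflexive total

  <⇒≱ : ∀ {x y} → x < y → ¬ y ≤ x
  <⇒≱ = Strict.<⇒≱ _≈_ _≤_ antisym

  x-y+y≈x : ∀ x y → (x - y) + y ≈ x
  x-y+y≈x x y = trans (+-assoc x (- y) y) (trans (+-congˡ (-‿inverseˡ y)) (+-identityʳ x))

  x+y-y≈x : ∀ x y → (x + y) - y ≈ x
  x+y-y≈x x y = trans (+-assoc x y (- y)) (trans (+-congˡ (-‿inverseʳ y)) (+-identityʳ x))

  +-monoˡ-≤ : ∀ x {y z} → y ≤ z → y + x ≤ z + x
  +-monoˡ-≤ x {y} {z} y≤z = begin
    y + x ≈⟨ +-comm y x ⟩
    x + y ≤⟨ +-monoʳ-≤ x y≤z ⟩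
    x + z ≈⟨ +-comm x z ⟩
    z + x ∎

  +-mono-≤ : ∀ {x y u v} → x ≤ y → u ≤ v → x + u ≤ y + v
  +-mono-≤ {y = y} {u} x≤y u≤v = ≤-trans (+-monoˡ-≤ u x≤y) (+-monoʳ-≤ y u≤v)

  +-cancelʳ-≤ : ∀ z {x y} → x + z ≤ y + z → x ≤ y
  +-cancelʳ-≤ z {x} {y} le = begin
    x           ≈⟨ x+y-y≈x x z ⟨
    (x + z) - z ≤⟨ +-monoˡ-≤ (- z) le ⟩
    (y + z) - z ≈⟨ x+y-y≈x y z ⟩
    y           ∎

  x≤z+y⇒x-y≤z : ∀ {x y z} → x ≤ z + y → x - y ≤ z
  x≤z+y⇒x-y≤z {x} {y} {z} le = begin
    x - y       ≤⟨ +-monoˡ-≤ (- y) le ⟩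
    (z + y) - y ≈⟨ x+y-y≈x z y ⟩
    z           ∎

  x+y≤z⇒x≤z-y : ∀ {x y z} → x + y ≤ z → x ≤ z - y
  x+y≤z⇒x≤z-y {x} {y} {z} le = begin
    x           ≈⟨ x+y-y≈x x y ⟨
    (x + y) - y ≤⟨ +-monoˡ-≤ (- y) le ⟩
    z - y       ∎

  x≤y⇒0≤y-x : ∀ {x y} → x ≤ y → 0# ≤ y - x
  x≤y⇒0≤y-x {x} {y} le = x+y≤z⇒x≤z-y (≤-trans (≤-reflexive (+-identityˡ x)) le)

  0≤y-x⇒x≤y : ∀ {x y} → 0# ≤ y - x → x ≤ y
  0≤y-x⇒x≤y {x} {y} le = begin
    x           ≈⟨ +-identityˡ x ⟨
    0# + x      ≤⟨ +-monoˡ-≤ x le ⟩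
    (y - x) + x ≈⟨ x-y+y≈x y x ⟩
    y           ∎

  +-nonNeg : ∀ {x y} → 0# ≤ x → 0# ≤ y → 0# ≤ x + y
  +-nonNeg 0≤x 0≤y = ≤-trans (≤-reflexive (sym (+-identityˡ 0#))) (+-mono-≤ 0≤x 0≤y)

  x≤x+y : ∀ x {y} → 0# ≤ y → x ≤ x + y
  x≤x+y x 0≤y = ≤-trans (≤-reflexive (sym (+-identityʳ x))) (+-monoʳ-≤ x 0≤y)

  x≤y+x : ∀ x {y} → 0# ≤ y → x ≤ y + x
  x≤y+x x 0≤y = ≤-trans (x≤x+y x 0≤y) (≤-reflexive (+-comm x _))

  *-monoˡ-≤ : ∀ {x y z} → 0# ≤ x → y ≤ z → x * y ≤ x * z
  *-monoˡ-≤ {x} {y} {z} 0≤x y≤z = 0≤y-x⇒x≤y (begin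
    0#            ≤⟨ *-nonNeg 0≤x (x≤y⇒0≤y-x y≤z) ⟩
    x * (z - y)   ≈⟨ x[y-z]≈xy-xz x z y ⟩
    x * z - x * y ∎)

  *-monoʳ-≤ : ∀ {x y z} → 0# ≤ x → y ≤ z → y * x ≤ z * x
  *-monoʳ-≤ {x} {y} {z} 0≤x y≤z = begin
    y * x ≈⟨ *-comm y x ⟩
    x * y ≤⟨ *-monoˡ-≤ 0≤x y≤z ⟩
    x * z ≈⟨ *-comm x z ⟩
    z * x ∎

  *-mono-≤ : ∀ {x y u v} → 0# ≤ u → 0# ≤ y → x ≤ y → u ≤ v → x * u ≤ y * v
  *-mono-≤ 0≤u 0≤y x≤y u≤v = ≤-trans (*-monoʳ-≤ 0≤u x≤y) (*-monoˡ-≤ 0≤y u≤v)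

  x≤0⇒0≤-x : ∀ {x} → x ≤ 0# → 0# ≤ - x
  x≤0⇒0≤-x {x} x≤0 = ≤-trans (x≤y⇒0≤y-x x≤0) (≤-reflexive (+-identityˡ (- x)))

  0≤1 : 0# ≤ 1#
  0≤1 with total 0# 1#
  ... | inj₁ 0≤1 = 0≤1
  ... | inj₂ 1≤0 = begin
    0#          ≤⟨ *-nonNeg (x≤0⇒0≤-x 1≤0) (x≤0⇒0≤-x 1≤0) ⟩
    - 1# * - 1# ≈⟨ -‿distribˡ-* 1# (- 1#) ⟨
    - (1# * - 1#) ≈⟨ -‿cong (*-identityˡ (- 1#)) ⟩
    - - 1#      ≈⟨ -‿involutive 1# ⟩
    1#          ∎

  0<1 : 0# < 1#
  0<1 = 0≤1 , 0≉1

  <⇒≉0 : ∀ {x} → 0# < x → ¬ x ≈ 0#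
  <⇒≉0 (_ , 0≉x) = 0≉x ∘ sym

  *-pos : ∀ {x y} → 0# < x → 0# < y → 0# < x * y
  *-pos {x} {y} 0<x@(0≤x , _) (0≤y , 0≉y) = *-nonNeg 0≤x 0≤y , λ 0≈xy → 0≉y (begin-equality
    0#              ≈⟨ zeroʳ (x ⁻¹) ⟨
    x ⁻¹ * 0#       ≈⟨ *-congˡ 0≈xy ⟩
    x ⁻¹ * (x * y)  ≈⟨ *-assoc (x ⁻¹) x y ⟨
    (x ⁻¹ * x) * y  ≈⟨ *-congʳ (trans (*-comm (x ⁻¹) x) (⁻¹-inverseʳ (<⇒≉0 0<x))) ⟩
    1# * y          ≈⟨ *-identityˡ y ⟩
    y               ∎)

  ⁻¹-inverseˡ : ∀ {x} → 0# < x → x ⁻¹ * x ≈ 1#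
  ⁻¹-inverseˡ {x} 0<x = trans (*-comm (x ⁻¹) x) (⁻¹-inverseʳ (<⇒≉0 0<x))

  ⁻¹-pos : ∀ {x} → 0# < x → 0# < x ⁻¹
  ⁻¹-pos {x} 0<x@(0≤x , _) with total 0# (x ⁻¹)
  ... | inj₁ 0≤x⁻¹ = 0≤x⁻¹ , λ 0≈x⁻¹ → 0≉1 (begin-equality
    0#       ≈⟨ zeroʳ x ⟨
    x * 0#   ≈⟨ *-congˡ 0≈x⁻¹ ⟩
    x * x ⁻¹ ≈⟨ ⁻¹-inverseʳ (<⇒≉0 0<x) ⟩
    1#       ∎)
  ... | inj₂ x⁻¹≤0 = ⊥-elim (<⇒≱ 0<1 (begin
    1#       ≈⟨ ⁻¹-inverseʳ (<⇒≉0 0<x) ⟨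
    x * x ⁻¹ ≤⟨ *-monoˡ-≤ 0≤x x⁻¹≤0 ⟩
    x * 0#   ≈⟨ zeroʳ x ⟩
    0#       ∎))

  ⁻¹-nonNeg : ∀ {x} → 0# < x → 0# ≤ x ⁻¹
  ⁻¹-nonNeg 0<x = proj₁ (⁻¹-pos 0<x)

  *-cancelˡ-≤ : ∀ {x y z} → 0# < x → x * y ≤ x * z → y ≤ z
  *-cancelˡ-≤ {x} {y} {z} 0<x le = begin
    y              ≈⟨ cancel y ⟨
    x ⁻¹ * (x * y) ≤⟨ *-monoˡ-≤ (⁻¹-nonNeg 0<x) le ⟩
    x ⁻¹ * (x * z) ≈⟨ cancel z ⟩
    z              ∎
    where
    cancel : ∀ u → x ⁻¹ * (x * u) ≈ u
    cancel u = trans (sym (*-assoc (x ⁻¹) x u)) (trans (*-congʳ (⁻¹-inverseˡ 0<x)) (*-identityˡ u))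

  x<y⇒0<y-x : ∀ {x y} → x < y → 0# < y - x
  x<y⇒0<y-x {x} {y} x<y = ≰⇒> (λ le → <⇒≱ x<y (begin
    y           ≈⟨ x-y+y≈x y x ⟨
    (y - x) + x ≤⟨ +-monoˡ-≤ x le ⟩
    0# + x      ≈⟨ +-identityˡ x ⟩
    x           ∎))

  fromℕ-nonNeg : ∀ n → 0# ≤ fromℕ n
  fromℕ-nonNeg zero    = ≤-refl
  fromℕ-nonNeg (suc n) = +-nonNeg 0≤1 (fromℕ-nonNeg n)

  fromℕ-mono-≤ : ∀ {m n} → m ℕ.≤ n → fromℕ m ≤ fromℕ n
  fromℕ-mono-≤ {n = n} z≤n = fromℕ-nonNeg n
  fromℕ-mono-≤ (s≤s m≤n)   = +-monoʳ-≤ 1# (fromℕ-mono-≤ m≤n)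

  fromℕ-pos : ∀ {n} → 1 ℕ.≤ n → 0# < fromℕ n
  fromℕ-pos {suc n} _ = ≰⇒> λ le → <⇒≱ 0<1 (≤-trans (x≤x+y 1# (fromℕ-nonNeg n)) le)

  ^-nonNeg : ∀ {x} n → 0# ≤ x → 0# ≤ x ^ n
  ^-nonNeg zero    0≤x = 0≤1
  ^-nonNeg (suc n) 0≤x = *-nonNeg 0≤x (^-nonNeg n 0≤x)

  ^-pos : ∀ {x} n → 0# < x → 0# < x ^ n
  ^-pos zero    0<x = 0<1
  ^-pos (suc n) 0<x = *-pos 0<x (^-pos n 0<x)

  ^-monoˡ-≤ : ∀ {x y} n → 0# ≤ x → x ≤ y → x ^ n ≤ y ^ n
  ^-monoˡ-≤ zero    0≤x x≤y = ≤-refl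
  ^-monoˡ-≤ (suc n) 0≤x x≤y =
    *-mono-≤ (^-nonNeg n 0≤x) (≤-trans 0≤x x≤y) x≤y (^-monoˡ-≤ n 0≤x x≤y)

  ^-≤1 : ∀ {x} n → 0# ≤ x → x ≤ 1# → x ^ n ≤ 1#
  ^-≤1 zero    0≤x x≤1 = ≤-refl
  ^-≤1 (suc n) 0≤x x≤1 =
    ≤-trans (*-mono-≤ (^-nonNeg n 0≤x) 0≤1 x≤1 (^-≤1 n 0≤x x≤1)) (≤-reflexive (*-identityˡ 1#))

  ^-anti-≤ : ∀ {x m n} → 0# ≤ x → x ≤ 1# → m ℕ.≤ n → x ^ n ≤ x ^ m
  ^-anti-≤ {n = n} 0≤x x≤1 z≤n = ^-≤1 n 0≤x x≤1
  ^-anti-≤ 0≤x x≤1 (s≤s m≤n)   = *-monoˡ-≤ 0≤x (^-anti-≤ 0≤x x≤1 m≤n)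

  𝟙 : Bool → Carrier
  𝟙 b = if b then 1# else 0#

  𝟙-nonNeg : ∀ b → 0# ≤ 𝟙 b
  𝟙-nonNeg true  = 0≤1
  𝟙-nonNeg false = ≤-refl

  𝟙≤1 : ∀ b → 𝟙 b ≤ 1#
  𝟙≤1 true  = ≤-refl
  𝟙≤1 false = 0≤1

  if≈𝟙* : ∀ b x → (if b then x else 0#) ≈ 𝟙 b * x
  if≈𝟙* true  x = sym (*-identityˡ x)
  if≈𝟙* false x = sym (zeroˡ x)

  if-glb : ∀ {a} {A : Set a} (a? : Dec A) {x y z} →
    (A → z ≤ x) → (¬ A → z ≤ y) → z ≤ (if does a? then x else y)
  if-glb (yes a) z≤x z≤y = z≤x a
  if-glb (no ¬a) z≤x z≤y = z≤y ¬a

  open Sum semiring using (sum-cong-≋; ∑-distrib-+)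

  sum-mono-≤ : ∀ {n} {f g : Fin n → Carrier} → (∀ j → f j ≤ g j) → sum f ≤ sum g
  sum-mono-≤ {zero}  f≤g = ≤-refl
  sum-mono-≤ {suc n} f≤g = +-mono-≤ (f≤g zero) (sum-mono-≤ (f≤g ∘ suc))

  sum-nonNeg : ∀ {n} {f : Fin n → Carrier} → (∀ j → 0# ≤ f j) → 0# ≤ sum f
  sum-nonNeg {zero}  0≤f = ≤-refl
  sum-nonNeg {suc n} 0≤f = +-nonNeg (0≤f zero) (sum-nonNeg (0≤f ∘ suc))

  term≤sum : ∀ {n} {f : Fin n → Carrier} → (∀ j → 0# ≤ f j) → ∀ j → f j ≤ sum f
  term≤sum 0≤f zero    = x≤x+y _ (sum-nonNeg (0≤f ∘ suc))
  term≤sum 0≤f (suc j) = ≤-trans (term≤sum (0≤f ∘ suc) j) (x≤y+x _ (0≤f zero))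

  sum-+₃ : ∀ {n} (f g h : Fin n → Carrier) →
    sum (λ l → f l + (g l + h l)) ≈ sum f + (sum g + sum h)
  sum-+₃ f g h = trans (∑-distrib-+ f (λ l → g l + h l)) (+-congˡ (∑-distrib-+ g h))

  sum-if-≟ : ∀ {n} (f : Fin n → Carrier) i → sum (λ j → 𝟙 (does (j Fin.≟ i)) * f j) ≈ f i
  sum-if-≟ {suc n} f zero = begin-equality
    1# * f zero + sum (λ j → 0# * f (suc j))
      ≈⟨ +-cong (*-identityˡ _) (sum-cong-≋ (λ j → zeroˡ (f (suc j)))) ⟩
    f zero + sum {n} (λ _ → 0#)              ≈⟨ +-congˡ (Sum.sum-replicate-zero semiring n) ⟩
    f zero + 0#                              ≈⟨ +-identityʳ _ ⟩
    f zero                                   ∎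
  sum-if-≟ {suc n} f (suc i) = trans (+-cong (zeroˡ _) (sum-if-≟ (f ∘ suc) i)) (+-identityˡ _)

-- Expectations under product measures, and a drift bound

module ExpectationProperties {c ℓ₁ ℓ₂} (K : OrderedField c ℓ₁ ℓ₂) where
  open OrderedField K hiding (zero)
  open OrderedFieldProperties K
  open FiniteProbability K
  open PartialOrderReasoning poset
  open Sum semiring using (sum-cong-≋; ∑-distrib-+; ∑-comm; *-distribˡ-sum; *-distribʳ-sum)

  ∏ : ∀ {a} {A : Set a} → (A → Carrier) → ∀ {t} → Vec A t → Carrier
  ∏ f []      = 1#
  ∏ f (x ∷ z) = f x * ∏ f z

  module _ {n} (q : Fin n → Carrier) where

    𝔼-cong : ∀ t {X Y} → (∀ z → X z ≈ Y z) → 𝔼-iid q t X ≈ 𝔼-iid q t Y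
    𝔼-cong zero    X≈Y = X≈Y []
    𝔼-cong (suc t) X≈Y = sum-cong-≋ λ j → *-congˡ {q j} (𝔼-cong t λ z → X≈Y (j ∷ z))

    𝔼-mono-≤ : (∀ j → 0# ≤ q j) → ∀ t {X Y} → (∀ z → X z ≤ Y z) → 𝔼-iid q t X ≤ 𝔼-iid q t Y
    𝔼-mono-≤ 0≤q zero    X≤Y = X≤Y []
    𝔼-mono-≤ 0≤q (suc t) X≤Y =
      sum-mono-≤ λ j → *-monoˡ-≤ (0≤q j) (𝔼-mono-≤ 0≤q t λ z → X≤Y (j ∷ z))

    𝔼-+ : ∀ t X Y → 𝔼-iid q t (λ z → X z + Y z) ≈ 𝔼-iid q t X + 𝔼-iid q t Y
    𝔼-+ zero    X Y = refl
    𝔼-+ (suc t) X Y = trans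
      (sum-cong-≋ λ j → trans (*-congˡ {q j} (𝔼-+ t (X ∘ (j ∷_)) (Y ∘ (j ∷_)))) (distribˡ (q j) _ _))
      (∑-distrib-+ (λ j → q j * 𝔼-iid q t (X ∘ (j ∷_))) (λ j → q j * 𝔼-iid q t (Y ∘ (j ∷_))))

    𝔼-*ʳ : ∀ t X a → 𝔼-iid q t (λ z → X z * a) ≈ 𝔼-iid q t X * a
    𝔼-*ʳ zero    X a = refl
    𝔼-*ʳ (suc t) X a = trans
      (sum-cong-≋ λ j → trans (*-congˡ {q j} (𝔼-*ʳ t (X ∘ (j ∷_)) a)) (sym (*-assoc (q j) _ a)))
      (sym (*-distribʳ-sum a (λ j → q j * 𝔼-iid q t (X ∘ (j ∷_)))))

    𝔼-*ˡ : ∀ t a X → 𝔼-iid q t (λ z → a * X z) ≈ a * 𝔼-iid q t X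
    𝔼-*ˡ t a X = trans (𝔼-cong t (λ z → *-comm a (X z))) (trans (𝔼-*ʳ t X a) (*-comm _ a))

    𝔼-sum : ∀ t {m} (X : Fin m → Vec (Fin n) t → Carrier) →
            𝔼-iid q t (λ z → sum (λ l → X l z)) ≈ sum (λ l → 𝔼-iid q t (X l))
    𝔼-sum zero    X = refl
    𝔼-sum (suc t) X = trans
      (sum-cong-≋ λ j → trans (*-congˡ {q j} (𝔼-sum t (λ l → X l ∘ (j ∷_))))
                              (*-distribˡ-sum (q j) (λ l → 𝔼-iid q t (X l ∘ (j ∷_)))))
      (∑-comm (λ j l → q j * 𝔼-iid q t (X l ∘ (j ∷_))))

    𝔼-∏ : ∀ t f → 𝔼-iid q t (∏ f) ≈ sum (λ j → q j * f j) ^ t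
    𝔼-∏ zero    f = refl
    𝔼-∏ (suc t) f = trans
      (sum-cong-≋ λ j → trans (*-congˡ {q j} (trans (𝔼-*ˡ t (f j) (∏ f)) (*-congˡ {f j} (𝔼-∏ t f))))
                              (sym (*-assoc (q j) (f j) _)))
      (sym (*-distribʳ-sum (sum (λ j → q j * f j) ^ t) (λ j → q j * f j)))

  module _ {n} {p : Fin n → Carrier} (dist : IsDistribution p) where
    open IsDistribution dist

    mean-const : ∀ a → sum (λ j → p j * a) ≈ a
    mean-const a = trans (sym (*-distribʳ-sum a p)) (trans (*-congʳ sumToOne) (*-identityˡ a))

    mean-+const : ∀ (f : Fin n → Carrier) a → sum (λ j → p j * (f j + a)) ≈ sum (λ j → p j * f j) + a
    mean-+const f a = trans (sum-cong-≋ λ j → distribˡ (p j) (f j) a)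
      (trans (∑-distrib-+ (λ j → p j * f j) (λ j → p j * a)) (+-congˡ (mean-const a)))

    -- `Φ` less `G` per request is a supermartingale. The induction peels off the first request,
    -- which `𝔼-iid` integrates outermost, so the starting history must vary. Folding with
    -- `flip _∷_` puts the newest request at the head, as the one-step hypothesis expects.
    𝔼-drift-≤ : (Φ : List (Fin n) → Carrier) (G : Carrier) →
      (∀ hist → sum (λ l → p l * Φ (l ∷ hist)) ≤ Φ hist + G) →
      ∀ t hist → 𝔼-iid p t (λ z → Φ (Vec.foldl′ (flip _∷_) hist z)) ≤ Φ hist + fromℕ t * G
    𝔼-drift-≤ Φ G step zero    hist = x≤x+y (Φ hist) (≤-reflexive {0#} (sym (zeroˡ G)))
    𝔼-drift-≤ Φ G step (suc t) hist = begin
      sum (λ l → p l * 𝔼-iid p t (λ z → Φ (Vec.foldl′ (flip _∷_) (l ∷ hist) z)))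
        ≤⟨ sum-mono-≤ (λ l → *-monoˡ-≤ (nonNeg l) (𝔼-drift-≤ Φ G step t (l ∷ hist))) ⟩
      sum (λ l → p l * (Φ (l ∷ hist) + fromℕ t * G))
        ≈⟨ mean-+const (λ l → Φ (l ∷ hist)) (fromℕ t * G) ⟩
      sum (λ l → p l * Φ (l ∷ hist)) + fromℕ t * G
        ≤⟨ +-monoˡ-≤ (fromℕ t * G) (step hist) ⟩
      (Φ hist + G) + fromℕ t * G
        ≈⟨ trans (+-assoc _ _ _) (+-congˡ {Φ hist} (+-congʳ {fromℕ t * G} (sym (*-identityˡ G)))) ⟩
      Φ hist + (1# * G + fromℕ t * G)
        ≈⟨ +-congˡ {Φ hist} (distribʳ G 1# (fromℕ t)) ⟨
      Φ hist + fromℕ (suc t) * G ∎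

-- Finite minima, and the sketch along a fixed history

-- Generic in the order because it serves both the counters in ℕ and the scalar minimum in `𝒜`.
minimum-glb : ∀ {a ℓ} {A : Set a} {_≤_ : Rel A ℓ} (_⊓_ : A → A → A) →
  (∀ {x y z} → x ≤ y → x ≤ z → x ≤ (y ⊓ z)) →
  ∀ {n} .{{_ : NonZero n}} (f : Fin n → A) {x} → (∀ r → x ≤ f r) → x ≤ minimum _⊓_ f
minimum-glb               _⊓_ glb {suc zero}    f x≤f = x≤f zero
minimum-glb {_≤_ = _≤_} _⊓_ glb {suc (suc n)} f x≤f =
  glb {_} {f zero} {minimum _⊓_ (f ∘ suc)} (x≤f zero)
    (minimum-glb {_≤_ = _≤_} _⊓_ glb (f ∘ suc) (x≤f ∘ suc))

minimum-≤ : ∀ {n} .{{_ : NonZero n}} (f : Fin n → ℕ) r → minimum ℕ._⊓_ f ℕ.≤ f r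
minimum-≤ {suc zero}    f zero    = ℕ.≤-refl
minimum-≤ {suc (suc n)} f zero    = ℕ.m⊓n≤m (f zero) _
minimum-≤ {suc (suc n)} f (suc r) =
  ℕ.≤-trans (ℕ.m⊓n≤n (f zero) _) (minimum-≤ (f ∘ suc) r)

<⇒+1≤ : ∀ {m n} → m ℕ.< n → m ℕ.+ 1 ℕ.≤ n
<⇒+1≤ {m} m<n rewrite ℕ.+-comm m 1 = m<n

countᵇ : ∀ {a} {A : Set a} → (A → Bool) → List A → ℕ
countᵇ b []       = 0
countᵇ b (x ∷ xs) = if b x then suc (countᵇ b xs) else countᵇ b xs

-- The most recent request comes first in a history.
module SketchProperties {d w N : ℕ} .{{_ : NonZero d}} (h : Fin d → Fin N → Fin w) where
  open CMS-CU h

  sketch : List (Fin N) → Sketch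
  sketch []         = empty
  sketch (l ∷ hist) = update (sketch hist) l

  requests : Fin N → List (Fin N) → ℕ
  requests i = countᵇ (λ l → does (l Fin.≟ i))

  load : Fin d → Fin N → List (Fin N) → ℕ
  load r j = countᵇ (λ l → does (h r j Fin.≟ h r l))

  estimate≤counter : ∀ C l r → estimate C l ℕ.≤ C r (h r l)
  estimate≤counter C l = minimum-≤ (λ r → C r (h r l))

  counter≤update : ∀ C l r a → C r a ℕ.≤ update C l r a
  counter≤update C l r a with does (a Fin.≟ h r l)
  ... | true  = ℕ.m≤m⊔n _ _
  ... | false = ℕ.≤-refl

  -- The estimate of l is at most each of its counters, so the target `estimate C l + 1` overshoots
  -- none of them by more than one.
  update≤suc-counter : ∀ C l r a → update C l r a ℕ.≤ suc (C r a)
  update≤suc-counter C l r a with a Fin.≟ h r l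
  ... | yes ≡.refl = ℕ.⊔-lub (ℕ.n≤1+n _)
        (<⇒+1≤ (s≤s (estimate≤counter C l r)))
  ... | no _       = ℕ.n≤1+n _

  -- The sketch never underestimates: the induction hypothesis holds in every row, hence for the
  -- minimum, and a request of i lifts each counter of i to at least that minimum plus one.
  requests≤counter : ∀ i hist r → requests i hist ℕ.≤ sketch hist r (h r i)
  requests≤counter i []         r = z≤n
  requests≤counter i (l ∷ hist) r with l Fin.≟ i
  ... | no _       = ℕ.≤-trans (requests≤counter i hist r) (counter≤update (sketch hist) l r (h r i))
  ... | yes ≡.refl with h r l Fin.≟ h r l
  ...   | no ≢   = contradiction ≡.refl ≢
  ...   | yes _  = ℕ.≤-trans
          (≡.subst (suc (requests i hist) ℕ.≤_) (ℕ.+-comm 1 _)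
            (s≤s (minimum-glb {_≤_ = ℕ._≤_} ℕ._⊓_ ℕ.⊓-glb _ (requests≤counter i hist))))
          (ℕ.m≤n⊔m (sketch hist r (h r l)) _)

  -- `load r j` is the counter of the plain count-min sketch, which dominates conservative update.
  counter≤load : ∀ hist r j → sketch hist r (h r j) ℕ.≤ load r j hist
  counter≤load []         r j = z≤n
  counter≤load (l ∷ hist) r j with h r j Fin.≟ h r l | update≤suc-counter (sketch hist) l r (h r j)
  ... | yes _ | le = ℕ.≤-trans le (s≤s (counter≤load hist r j))
  ... | no _  | _  = counter≤load hist r j

  -- If the estimate of l is below the counter of i, the maximum in `update` returns the old value.
  -- Otherwise, for every row f: requests of i ≤ counter of i ≤ estimate of l ≤ counter of l in row
  -- f ≤ `load f l`.
  increment : ∀ i hist l r →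
    sketch (l ∷ hist) r (h r i) ≡ sketch hist r (h r i)
    ⊎ (h r i ≡ h r l × (∀ f → requests i hist ℕ.≤ load f l hist))
  increment i hist l r with h r i Fin.≟ h r l
  ... | no _  = inj₁ ≡.refl
  ... | yes e with sketch hist r (h r i) ℕ.≤? estimate (sketch hist) l
  ...   | yes c≤est = inj₂ (e , λ f → ℕ.≤-trans (requests≤counter i hist r) (ℕ.≤-trans c≤est
            (ℕ.≤-trans (estimate≤counter (sketch hist) l f) (counter≤load hist f l))))
  ...   | no c≰est  = inj₁ (ℕ.m≥n⇒m⊔n≡m
            (<⇒+1≤ (ℕ.≰⇒> c≰est)))

  sketch-foldl : ∀ hist {t} (z : Vec (Fin N) t) →
    sketch (Vec.foldl′ (flip _∷_) hist z) ≡ Vec.foldl′ update (sketch hist) z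
  sketch-foldl hist []      = ≡.refl
  sketch-foldl hist (l ∷ z) = sketch-foldl (l ∷ hist) z

  requests-foldl : ∀ i hist {t} (z : Vec (Fin N) t) →
    requests i (Vec.foldl′ (flip _∷_) hist z) ≡ requests i hist ℕ.+ occurrences z i
  requests-foldl i hist []      = ≡.sym (ℕ.+-identityʳ _)
  requests-foldl i hist (l ∷ z) with l Fin.≟ i | requests-foldl i (l ∷ hist) z
  ... | yes _ | eq = ≡.trans eq (≡.sym (ℕ.+-suc _ _))
  ... | no _  | eq = eq

-- Charges, and walks with negative drift

module Charges {c ℓ₁ ℓ₂} (K : OrderedField c ℓ₁ ℓ₂) where
  open OrderedField K hiding (zero)
  open OrderedFieldProperties K
  open FiniteProbability K
  open ExpectationProperties K
  open PartialOrderReasoning poset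
  open Sum semiring using (sum-cong-≋; *-distribʳ-sum)
  open SemiringSolver commutativeSemiring using (solve; _:=_; _:+_; _:*_; con)

  module _ {N : ℕ} (p : Fin N → Carrier) where

    -- A charge for an event P of histories pays for each occurrence of P by κ
    -- plus the drop of the potential V in conditional mean.
    record Charge (P : List (Fin N) → Set) (κ : Carrier) : Set (c Level.⊔ ℓ₂) where
      field
        e V      : List (Fin N) → Carrier
        e-nonNeg : ∀ hist → 0# ≤ e hist
        V-nonNeg : ∀ hist → 0# ≤ V hist
        cover    : ∀ hist → P hist → 1# ≤ κ + e hist
        drift    : ∀ hist → sum (λ l → p l * V (l ∷ hist)) + e hist ≤ V hist

  module _ {N : ℕ} {p : Fin N → Carrier} where

    mapCharge : ∀ {P Q κ κ′} → (∀ hist → Q hist → P hist) → κ ≈ κ′ → Charge p P κ → Charge p Q κ′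
    mapCharge Q⇒P κ≈κ′ ch = record
      { Charge ch
      ; cover = λ hist Qh →
          ≤-trans (Charge.cover ch hist (Q⇒P hist Qh)) (≤-reflexive (+-congʳ κ≈κ′))
      }

    -- Paying the full unit at each occurrence requires no potential. This is the fallback when no
    -- row offers a negative drift.
    unitCharge : ∀ {P} → Charge p P 1#
    unitCharge = record
      { e        = λ _ → 0#
      ; V        = λ _ → 0#
      ; e-nonNeg = λ _ → ≤-refl
      ; V-nonNeg = λ _ → ≤-refl
      ; cover    = λ _ _ → ≤-reflexive (sym (+-identityʳ 1#))
      ; drift    = λ _ → ≤-reflexive (trans (+-identityʳ _)
                     (trans (sum-cong-≋ λ l → zeroʳ (p l)) (Sum.sum-replicate-zero semiring N)))
      }

  module _ {N : ℕ} {p : Fin N → Carrier} (dist : IsDistribution p) (i : Fin N) where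
    open IsDistribution dist

    -- Below the drift p i of i, a bucket b gives a negative drift to the walk
    -- (requests in b) − (requests of i).  Exponentiating it with a base θ
    -- strictly between 1 and p i / q yields a supermartingale W that contracts
    -- by a factor ρ < 1, so that W / (1 − ρ) pays for all visits to ≥ 0.
    module NegativeDrift (b : Fin N → Bool) (q<a : sum (λ l → 𝟙 (b l) * p l) < p i) where

      -- `φ` is the midpoint of q / a and 1, hence strictly between them and positive even when q =
      -- 0, where p i / q would make no sense as an upper limit for `θ`.
      q a φ θ : Carrier
      q = sum (λ l → 𝟙 (b l) * p l)
      a = p i
      φ = (q + a) * (a + a) ⁻¹
      θ = φ ⁻¹

      0≤q : 0# ≤ q
      0≤q = sum-nonNeg λ l → *-nonNeg (𝟙-nonNeg (b l)) (nonNeg l)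

      0<a : 0# < a
      0<a = ≰⇒> λ a≤0 → <⇒≱ q<a (≤-trans a≤0 0≤q)

      0<a+a : 0# < a + a
      0<a+a = ≰⇒> λ le → <⇒≱ 0<a (≤-trans (x≤x+y a (proj₁ 0<a)) le)

      φ*[a+a] : φ * (a + a) ≈ q + a
      φ*[a+a] = trans (*-assoc (q + a) _ _) (trans (*-congˡ (⁻¹-inverseˡ 0<a+a)) (*-identityʳ _))

      φ<1 : φ < 1#
      φ<1 = ≰⇒> λ 1≤φ → <⇒≱ q<a (+-cancelʳ-≤ a (begin
        a + a        ≈⟨ *-identityˡ _ ⟨
        1# * (a + a) ≤⟨ *-monoʳ-≤ (proj₁ 0<a+a) 1≤φ ⟩
        φ * (a + a)  ≈⟨ φ*[a+a] ⟩
        q + a        ∎))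

      q<a*φ : q < a * φ
      q<a*φ = ≰⇒> λ aφ≤q → <⇒≱ q<a (+-cancelʳ-≤ q (begin
        a + q         ≈⟨ +-comm a q ⟩
        q + a         ≈⟨ φ*[a+a] ⟨
        φ * (a + a)   ≈⟨ trans (distribˡ φ a a) (+-cong (*-comm φ a) (*-comm φ a)) ⟩
        a * φ + a * φ ≤⟨ +-mono-≤ aφ≤q aφ≤q ⟩
        q + q         ∎))

      0<φ : 0# < φ
      0<φ = ≰⇒> λ φ≤0 → <⇒≱ q<a*φ (begin
        a * φ  ≤⟨ *-monoˡ-≤ (proj₁ 0<a) φ≤0 ⟩
        a * 0# ≈⟨ zeroʳ a ⟩
        0#     ≤⟨ 0≤q ⟩
        q      ∎)

      0<θ : 0# < θ
      0<θ = ⁻¹-pos 0<φ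

      θ*φ≈1 : θ * φ ≈ 1#
      θ*φ≈1 = ⁻¹-inverseˡ 0<φ

      -- The gap is θ (1 − φ) (a φ − q).
      mean-gap : q * θ + a * φ < q + a
      mean-gap = ≰⇒> λ le → <⇒≱ 0<gap (+-cancelʳ-≤ (q * θ + a * φ) (begin
        gap + (q * θ + a * φ)  ≈⟨ gap-eq ⟩
        q + a                  ≤⟨ le ⟩
        q * θ + a * φ          ≈⟨ +-identityˡ _ ⟨
        0# + (q * θ + a * φ)   ∎))
        where
        u v gap : Carrier
        u   = 1# - φ
        v   = a * φ - q
        gap = θ * (u * v)

        0<gap : 0# < gap
        0<gap = *-pos 0<θ (*-pos (x<y⇒0<y-x φ<1) (x<y⇒0<y-x q<a*φ))

        θ≈1+θu : θ ≈ 1# + θ * u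
        θ≈1+θu = begin-equality
          θ             ≈⟨ *-identityʳ θ ⟨
          θ * 1#        ≈⟨ *-congˡ (x-y+y≈x 1# φ) ⟨
          θ * (u + φ)   ≈⟨ distribˡ θ u φ ⟩
          θ * u + θ * φ ≈⟨ +-congˡ θ*φ≈1 ⟩
          θ * u + 1#    ≈⟨ +-comm _ _ ⟩
          1# + θ * u    ∎

        a≈θ[v+q] : a ≈ θ * (v + q)
        a≈θ[v+q] = begin-equality
          a           ≈⟨ *-identityˡ a ⟨
          1# * a      ≈⟨ *-congʳ θ*φ≈1 ⟨
          θ * φ * a   ≈⟨ trans (*-assoc θ φ a) (*-congˡ (*-comm φ a)) ⟩
          θ * (a * φ) ≈⟨ *-congˡ (x-y+y≈x (a * φ) q) ⟨
          θ * (v + q) ∎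

        gap-eq : gap + (q * θ + a * φ) ≈ q + a
        gap-eq = begin-equality
          gap + (q * θ + a * φ)        ≈⟨ +-congˡ (+-congˡ (x-y+y≈x (a * φ) q)) ⟨
          gap + (q * θ + (v + q))
            ≈⟨ solve 4 (λ θ u v q → θ :* (u :* v) :+ (q :* θ :+ (v :+ q)) :=
                          q :+ ((con 1 :+ θ :* u) :* v :+ θ :* q)) refl θ u v q ⟩
          q + ((1# + θ * u) * v + θ * q) ≈⟨ +-congˡ (+-congʳ (*-congʳ θ≈1+θu)) ⟨
          q + (θ * v + θ * q)          ≈⟨ +-congˡ (distribˡ θ v q) ⟨
          q + θ * (v + q)              ≈⟨ +-congˡ a≈θ[v+q] ⟨
          q + a                        ∎

      -- A bucket containing i would weigh at least p i. Hence no single request moves the walk both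
      -- up and down.
      b[i]≡false : b i ≡ false
      b[i]≡false with b i in eq
      ... | false = ≡.refl
      ... | true  = contradiction (begin
        a                ≈⟨ *-identityˡ a ⟨
        1# * a           ≡⟨ ≡.cong (λ x → 𝟙 x * a) eq ⟨
        𝟙 (b i) * a      ≤⟨ term≤sum {f = λ l → 𝟙 (b l) * p l}
                              (λ l → *-nonNeg (𝟙-nonNeg (b l)) (nonNeg l)) i ⟩
        q                ∎) (<⇒≱ q<a)

      -- The factor by which a request multiplies `W`: `θ` for a step up, its inverse `φ` for a step
      -- down.
      g : Fin N → Carrier
      g l = if b l then θ else if does (l Fin.≟ i) then φ else 1#

      -- `β` is the sum of the geometric series with ratio `ρ`; its fixed-point equation `ρβ+1≈β`
      -- turns the drift condition of `charge` into an equality.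
      ρ β : Carrier
      ρ = sum (λ l → p l * g l)
      β = (1# - ρ) ⁻¹

      -- The mean of `g` is 1 - q - a + qθ + aφ; the negative terms are moved across so that
      -- semiring identities suffice.
      mean-g : ρ + (q + a) ≈ 1# + (q * θ + a * φ)
      mean-g = begin-equality
        ρ + (q + a)
          ≈⟨ +-congˡ (+-congˡ (sum-if-≟ p i)) ⟨
        ρ + (q + sum (λ l → 𝟙 (does (l Fin.≟ i)) * p l))
          ≈⟨ sum-+₃ (λ l → p l * g l) (λ l → 𝟙 (b l) * p l) (λ l → 𝟙 (does (l Fin.≟ i)) * p l) ⟨
        sum (λ l → p l * g l + (𝟙 (b l) * p l + 𝟙 (does (l Fin.≟ i)) * p l))
          ≈⟨ sum-cong-≋ pointwise ⟩
        sum (λ l → p l + (𝟙 (b l) * p l * θ + 𝟙 (does (l Fin.≟ i)) * p l * φ))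
          ≈⟨ sum-+₃ p (λ l → 𝟙 (b l) * p l * θ) (λ l → 𝟙 (does (l Fin.≟ i)) * p l * φ) ⟩
        sum p + (sum (λ l → 𝟙 (b l) * p l * θ) + sum (λ l → 𝟙 (does (l Fin.≟ i)) * p l * φ))
          ≈⟨ +-cong (sym sumToOne) (+-cong (*-distribʳ-sum θ (λ l → 𝟙 (b l) * p l))
               (*-distribʳ-sum φ (λ l → 𝟙 (does (l Fin.≟ i)) * p l))) ⟨
        1# + (q * θ + sum (λ l → 𝟙 (does (l Fin.≟ i)) * p l) * φ)
          ≈⟨ +-congˡ (+-congˡ (*-congʳ (sum-if-≟ p i))) ⟩
        1# + (q * θ + a * φ) ∎
        where
        pointwise : ∀ l → p l * g l + (𝟙 (b l) * p l + 𝟙 (does (l Fin.≟ i)) * p l)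
                        ≈ p l + (𝟙 (b l) * p l * θ + 𝟙 (does (l Fin.≟ i)) * p l * φ)
        pointwise l with b l in eq | l Fin.≟ i
        ... | true | yes ≡.refl = contradiction (≡.trans (≡.sym eq) b[i]≡false) λ ()
        ... | true | no _ = solve 3 (λ x θ φ → x :* θ :+ (con 1 :* x :+ con 0 :* x) :=
                              x :+ (con 1 :* x :* θ :+ con 0 :* x :* φ)) refl (p l) θ φ
        ... | false | yes _ = solve 3 (λ x θ φ → x :* φ :+ (con 0 :* x :+ con 1 :* x) :=
                              x :+ (con 0 :* x :* θ :+ con 1 :* x :* φ)) refl (p l) θ φ
        ... | false | no _ = solve 3 (λ x θ φ → x :* con 1 :+ (con 0 :* x :+ con 0 :* x) :=
                              x :+ (con 0 :* x :* θ :+ con 0 :* x :* φ)) refl (p l) θ φ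

      ρ<1 : ρ < 1#
      ρ<1 = ≰⇒> λ 1≤ρ → <⇒≱ mean-gap (+-cancelʳ-≤ 1# (begin
        (q + a) + 1#           ≤⟨ +-monoʳ-≤ (q + a) 1≤ρ ⟩
        (q + a) + ρ            ≈⟨ +-comm _ _ ⟩
        ρ + (q + a)            ≈⟨ mean-g ⟩
        1# + (q * θ + a * φ)   ≈⟨ +-comm _ _ ⟩
        (q * θ + a * φ) + 1#   ∎))

      0<1-ρ : 0# < 1# - ρ
      0<1-ρ = x<y⇒0<y-x ρ<1

      ρβ+1≈β : ρ * β + 1# ≈ β
      ρβ+1≈β = begin-equality
        ρ * β + 1#             ≈⟨ +-congˡ (⁻¹-inverseʳ (<⇒≉0 0<1-ρ)) ⟨
        ρ * β + (1# - ρ) * β   ≈⟨ distribʳ β ρ (1# - ρ) ⟨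
        (ρ + (1# - ρ)) * β     ≈⟨ *-congʳ (trans (+-comm _ _) (x-y+y≈x 1# ρ)) ⟩
        1# * β                 ≈⟨ *-identityˡ β ⟩
        β                      ∎

      W : List (Fin N) → Carrier
      W []         = 1#
      W (l ∷ hist) = g l * W hist

      g-nonNeg : ∀ l → 0# ≤ g l
      g-nonNeg l with b l
      ... | true = proj₁ 0<θ
      ... | false with does (l Fin.≟ i)
      ...   | true  = proj₁ 0<φ
      ...   | false = 0≤1

      W-nonNeg : ∀ hist → 0# ≤ W hist
      W-nonNeg []         = 0≤1
      W-nonNeg (l ∷ hist) = *-nonNeg (g-nonNeg l) (W-nonNeg hist)

      -- W = θ ^ Y · φ ^ n for Y requests in b and n requests of i, with θ moved across.
      W-count : ∀ hist →
        φ ^ countᵇ b hist * W hist ≈ φ ^ countᵇ (λ l → does (l Fin.≟ i)) hist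
      W-count []         = *-identityˡ 1#
      W-count (l ∷ hist) with b l in eq | l Fin.≟ i
      ... | true | yes ≡.refl = contradiction (≡.trans (≡.sym eq) b[i]≡false) λ ()
      ... | true | no _ = begin-equality
        φ * φ ^ Y * (θ * W hist)
          ≈⟨ solve 4 (λ φ x θ y → φ :* x :* (θ :* y) := θ :* φ :* (x :* y)) refl
               φ (φ ^ Y) θ (W hist) ⟩
        θ * φ * (φ ^ Y * W hist)   ≈⟨ *-cong θ*φ≈1 (W-count hist) ⟩
        1# * φ ^ n                 ≈⟨ *-identityˡ _ ⟩
        φ ^ n                      ∎
        where
        Y n : ℕ
        Y = countᵇ b hist
        n = countᵇ (λ l → does (l Fin.≟ i)) hist
      ... | false | yes _ = trans
        (solve 3 (λ φ x y → x :* (φ :* y) := φ :* (x :* y)) refl φ (φ ^ countᵇ b hist) (W hist))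
        (*-congˡ (W-count hist))
      ... | false | no _ = trans (*-congˡ (*-identityˡ (W hist))) (W-count hist)

      -- With n ≤ Y the exponent of `θ` in `W` is not negative, and `θ` exceeds 1. The comparison is
      -- made after multiplying by `φ ^ Y`, where it reads `φ ^ Y` ≤ `φ ^ n`.
      1≤W : ∀ hist → countᵇ (λ l → does (l Fin.≟ i)) hist ℕ.≤ countᵇ b hist → 1# ≤ W hist
      1≤W hist n≤Y = *-cancelˡ-≤ (^-pos Y 0<φ) (begin
        φ ^ Y * 1#     ≈⟨ *-identityʳ _ ⟩
        φ ^ Y          ≤⟨ ^-anti-≤ (proj₁ 0<φ) (proj₁ φ<1) n≤Y ⟩
        φ ^ countᵇ (λ l → does (l Fin.≟ i)) hist ≈⟨ W-count hist ⟨
        φ ^ Y * W hist ∎)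
        where
        Y : ℕ
        Y = countᵇ b hist

      -- `W` alone pays a unit at each visit, so the price is 0. The potential `β * W` is the
      -- expected sum of `W` over the present and all future times, since its mean shrinks by `ρ` at
      -- each request.
      charge : Charge p (λ hist → countᵇ (λ l → does (l Fin.≟ i)) hist ℕ.≤ countᵇ b hist) 0#
      charge = record
        { e        = W
        ; V        = λ hist → β * W hist
        ; e-nonNeg = W-nonNeg
        ; V-nonNeg = λ hist → *-nonNeg (⁻¹-nonNeg 0<1-ρ) (W-nonNeg hist)
        ; cover    = λ hist n≤Y → ≤-trans (1≤W hist n≤Y) (≤-reflexive (sym (+-identityˡ (W hist))))
        ; drift    = λ hist → ≤-reflexive (begin-equality
            sum (λ l → p l * (β * (g l * W hist))) + W hist
              ≈⟨ +-congʳ (sum-cong-≋ λ l →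
                   solve 4 (λ x β g y → x :* (β :* (g :* y)) := x :* g :* (β :* y)) refl
                     (p l) β (g l) (W hist)) ⟩
            sum (λ l → p l * g l * (β * W hist)) + W hist
              ≈⟨ +-congʳ (*-distribʳ-sum (β * W hist) (λ l → p l * g l)) ⟨
            ρ * (β * W hist) + W hist
              ≈⟨ solve 3 (λ ρ β y → ρ :* (β :* y) :+ y := (ρ :* β :+ con 1) :* y) refl ρ β (W hist) ⟩
            (ρ * β + 1#) * W hist
              ≈⟨ *-congʳ ρβ+1≈β ⟩
            β * W hist ∎)
        }

-- Growth of the error for fixed hash functions

module ErrorPotential {c ℓ₁ ℓ₂} (K : OrderedField c ℓ₁ ℓ₂) where
  open OrderedField K hiding (zero)
  open OrderedFieldProperties K
  open FiniteProbability K
  open ExpectationProperties K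
  open Charges K
  open Error K
  open PartialOrderReasoning poset
  open RingProperties ring using (-‿+-comm)
  open Sum semiring using (sum-cong-≋; ∑-distrib-+; ∑-comm; *-distribˡ-sum)
  open SemiringSolver commutativeSemiring using (solve; _:=_; _:+_; _:*_)

  -- The charges concern only the rows after the first, so their prices `κ` can be chosen without
  -- looking at the first row. This later permits averaging over the two parts separately.
  module Bound {N w d : ℕ} {p : Fin N → Carrier} (dist : IsDistribution p) (i : Fin N)
    (h : Fin (suc d) → Fin N → Fin w)
    (κ : Fin N → Carrier) (κ-nonNeg : ∀ j → 0# ≤ κ j)
    (charges : ∀ j → Charge p (λ hist → ∀ r → countᵇ (λ l → does (l Fin.≟ i)) hist
      ℕ.≤ countᵇ (λ l → does (h (suc r) j Fin.≟ h (suc r) l)) hist) (κ j))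
    where
    open IsDistribution dist
    open CMS-CU h
    open SketchProperties h

    module Ch (j : Fin N) = Charge (charges j)

    κ⁰ : Fin N → Carrier
    κ⁰ l = 𝟙 (not (does (l Fin.≟ i))) * (𝟙 (does (h zero i Fin.≟ h zero l)) * κ l)

    κ⁰-nonNeg : ∀ l → 0# ≤ κ⁰ l
    κ⁰-nonNeg l = *-nonNeg (𝟙-nonNeg (not (does (l Fin.≟ i))))
      (*-nonNeg (𝟙-nonNeg (does (h zero i Fin.≟ h zero l))) (κ-nonNeg l))

    excess : List (Fin N) → Carrier
    excess hist = fromℕ (sketch hist zero (h zero i)) - fromℕ (requests i hist)

    [1+x]-[1+y]≈x-y : ∀ x y → (1# + x) - (1# + y) ≈ x - y
    [1+x]-[1+y]≈x-y x y = begin-equality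
      (1# + x) + - (1# + y)     ≈⟨ +-cong (+-comm 1# x) (sym (-‿+-comm 1# y)) ⟩
      (x + 1#) + (- 1# + - y)   ≈⟨ +-assoc (x + 1#) (- 1#) (- y) ⟨
      (x + 1#) - 1# + - y       ≈⟨ +-congʳ (x+y-y≈x x 1#) ⟩
      x - y                     ∎

    suc-excess : ∀ {a b n y} → a ℕ.≤ suc b → 1# ≤ y → fromℕ a - fromℕ n ≤ (fromℕ b - fromℕ n) + y
    suc-excess {a} {b} {n} {y} a≤1+b 1≤y = begin
      fromℕ a - fromℕ n
        ≤⟨ +-monoˡ-≤ _ (fromℕ-mono-≤ a≤1+b) ⟩
      (1# + fromℕ b) - fromℕ n
        ≈⟨ solve 3 (λ x y z → (x :+ y) :+ z := (y :+ z) :+ x) refl 1# (fromℕ b) (- fromℕ n) ⟩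
      (fromℕ b - fromℕ n) + 1#
        ≤⟨ +-monoʳ-≤ _ 1≤y ⟩
      (fromℕ b - fromℕ n) + y ∎

    -- A request of i raises its count by one and the counter by at most one. Any other request that
    -- changes the counter collides with i, so that `κ⁰ l` is `κ l`, and happens at a history in the
    -- event of the charge of l, so `κ l` and `e` together pay for the increment.
    excess-step : ∀ hist l → excess (l ∷ hist) ≤ excess hist + (κ⁰ l + Ch.e l hist)
    excess-step hist l with l Fin.≟ i | increment i hist l zero | κ⁰-nonNeg l
                          | update≤suc-counter (sketch hist) l zero (h zero i)
    ... | yes _ | _ | 0≤κ⁰ | le = begin
      fromℕ (sketch (l ∷ hist) zero (h zero i)) - fromℕ (suc (requests i hist))
        ≤⟨ +-monoˡ-≤ _ (fromℕ-mono-≤ le) ⟩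
      fromℕ (suc (sketch hist zero (h zero i))) - fromℕ (suc (requests i hist))
        ≈⟨ [1+x]-[1+y]≈x-y _ _ ⟩
      excess hist
        ≤⟨ x≤x+y _ (+-nonNeg 0≤κ⁰ (Ch.e-nonNeg l hist)) ⟩
      excess hist + _ ∎
    ... | no _ | inj₁ eq | 0≤κ⁰ | _ = begin
      fromℕ (sketch (l ∷ hist) zero (h zero i)) - fromℕ (requests i hist)
        ≡⟨ ≡.cong (λ n → fromℕ n - fromℕ (requests i hist)) eq ⟩
      excess hist
        ≤⟨ x≤x+y _ (+-nonNeg 0≤κ⁰ (Ch.e-nonNeg l hist)) ⟩
      excess hist + _ ∎
    ... | no _ | inj₂ (coll , n≤Y) | _ | le with h zero i Fin.≟ h zero l
    ...   | no ¬coll = contradiction coll ¬coll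
    -- Composing with `suc` drops the first row, leaving the event that the charge of l covers.
    ...   | yes _    = ≤-trans (suc-excess {n = requests i hist} le (Ch.cover l hist (n≤Y ∘ suc)))
      (≤-reflexive (+-congˡ (+-congʳ (sym (trans (*-identityˡ _) (*-identityˡ _))))))

    -- The charge of j has to pay only when j is the next request, hence the weight p j.
    potential : List (Fin N) → Carrier
    potential hist = sum (λ j → p j * Ch.V j hist)

    potential-nonNeg : ∀ hist → 0# ≤ potential hist
    potential-nonNeg hist = sum-nonNeg λ j → *-nonNeg (nonNeg j) (Ch.V-nonNeg j hist)

    rate : Carrier
    rate = sum (λ l → p l * κ⁰ l)

    potential-drift : ∀ hist →
      sum (λ l → p l * potential (l ∷ hist)) + sum (λ j → p j * Ch.e j hist) ≤ potential hist
    potential-drift hist = begin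
      sum (λ l → p l * sum (λ j → p j * Ch.V j (l ∷ hist))) + sum (λ j → p j * Ch.e j hist)
        ≈⟨ +-congʳ (sum-cong-≋ λ l → *-distribˡ-sum (p l) (λ j → p j * Ch.V j (l ∷ hist))) ⟩
      sum (λ l → sum (λ j → p l * (p j * Ch.V j (l ∷ hist)))) + sum (λ j → p j * Ch.e j hist)
        ≈⟨ +-congʳ (∑-comm (λ l j → p l * (p j * Ch.V j (l ∷ hist)))) ⟩
      sum (λ j → sum (λ l → p l * (p j * Ch.V j (l ∷ hist)))) + sum (λ j → p j * Ch.e j hist)
        ≈⟨ +-congʳ (sum-cong-≋ λ j → trans
             (sum-cong-≋ λ l → solve 3 (λ x y z → x :* (y :* z) := y :* (x :* z)) refl
               (p l) (p j) (Ch.V j (l ∷ hist)))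
             (sym (*-distribˡ-sum (p j) (λ l → p l * Ch.V j (l ∷ hist))))) ⟩
      sum (λ j → p j * sum (λ l → p l * Ch.V j (l ∷ hist))) + sum (λ j → p j * Ch.e j hist)
        ≈⟨ ∑-distrib-+ (λ j → p j * sum (λ l → p l * Ch.V j (l ∷ hist))) (λ j → p j * Ch.e j hist) ⟨
      sum (λ j → p j * sum (λ l → p l * Ch.V j (l ∷ hist)) + p j * Ch.e j hist)
        ≈⟨ sum-cong-≋ (λ j → distribˡ (p j) (sum (λ l → p l * Ch.V j (l ∷ hist))) (Ch.e j hist)) ⟨
      sum (λ j → p j * (sum (λ l → p l * Ch.V j (l ∷ hist)) + Ch.e j hist))
        ≤⟨ sum-mono-≤ (λ j → *-monoˡ-≤ (nonNeg j) (Ch.drift j hist)) ⟩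
      potential hist ∎

    -- The payments `Ch.e l hist` have mean Σ p l · e l, which the mean drop of `potential` covers.
    -- Only the prices remain, and their mean is `rate`.
    total-drift : ∀ hist → sum (λ l → p l * (excess (l ∷ hist) + potential (l ∷ hist)))
                         ≤ (excess hist + potential hist) + rate
    total-drift hist = begin
      sum (λ l → p l * (excess (l ∷ hist) + potential (l ∷ hist)))
        ≤⟨ sum-mono-≤ (λ l → *-monoˡ-≤ (nonNeg l)
             (+-monoˡ-≤ (potential (l ∷ hist)) (excess-step hist l))) ⟩
      sum (λ l → p l * ((excess hist + (κ⁰ l + Ch.e l hist)) + potential (l ∷ hist)))
        ≈⟨ sum-cong-≋ (λ l → solve 5 (λ x a b c d → x :* ((a :+ (b :+ c)) :+ d) :=
             x :* b :+ (x :* d :+ x :* c) :+ x :* a) refl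
             (p l) (excess hist) (κ⁰ l) (Ch.e l hist) (potential (l ∷ hist))) ⟩
      sum (λ l → (p l * κ⁰ l + (p l * potential (l ∷ hist) + p l * Ch.e l hist)) + p l * excess hist)
        ≈⟨ ∑-distrib-+ (λ l → p l * κ⁰ l + (p l * potential (l ∷ hist) + p l * Ch.e l hist))
                       (λ l → p l * excess hist) ⟩
      sum (λ l → p l * κ⁰ l + (p l * potential (l ∷ hist) + p l * Ch.e l hist))
        + sum (λ l → p l * excess hist)
        ≈⟨ +-cong
             (sum-+₃ (λ l → p l * κ⁰ l) (λ l → p l * potential (l ∷ hist)) (λ l → p l * Ch.e l hist))
             (mean-const dist (excess hist)) ⟩
      (rate + (sum (λ l → p l * potential (l ∷ hist)) + sum (λ l → p l * Ch.e l hist))) + excess hist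
        ≤⟨ +-monoˡ-≤ (excess hist) (+-monoʳ-≤ rate (potential-drift hist)) ⟩
      (rate + potential hist) + excess hist
        ≈⟨ solve 3 (λ x y z → (x :+ y) :+ z := (z :+ y) :+ x) refl
             rate (potential hist) (excess hist) ⟩
      (excess hist + potential hist) + rate ∎

    error≤excess : ∀ {t} (z : Vec (Fin N) t) → error h z i ≤ excess (Vec.foldl′ (flip _∷_) [] z)
    error≤excess z = begin
      fromℕ (estimate (process z) i) - fromℕ (occurrences z i)
        ≤⟨ +-monoˡ-≤ _ (fromℕ-mono-≤ (estimate≤counter (process z) i zero)) ⟩
      fromℕ (process z zero (h zero i)) - fromℕ (occurrences z i)
        ≡⟨ ≡.cong₂ (λ C n → fromℕ (C zero (h zero i)) - fromℕ n)
             (sketch-foldl [] z) (requests-foldl i [] z) ⟨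
      excess (Vec.foldl′ (flip _∷_) [] z) ∎

    -- Adding the nonnegative `potential` at time t only weakens the bound on the error; the drift
    -- bound then leaves its value at the empty history, where the excess is 0.
    𝔼-error-≤ : ∀ t → 𝔼-iid p t (λ z → error h z i) ≤ potential [] + fromℕ t * rate
    𝔼-error-≤ t = begin
      𝔼-iid p t (λ z → error h z i)
        ≤⟨ 𝔼-mono-≤ p nonNeg t (λ z → ≤-trans (error≤excess z)
             (x≤x+y _ (potential-nonNeg _))) ⟩
      𝔼-iid p t (λ z → Φ (Vec.foldl′ (flip _∷_) [] z))
        ≤⟨ 𝔼-drift-≤ dist Φ rate total-drift t [] ⟩
      (0# - 0# + potential []) + fromℕ t * rate
        ≈⟨ +-congʳ (trans (+-congʳ (-‿inverseʳ 0#)) (+-identityˡ _)) ⟩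
      potential [] + fromℕ t * rate ∎
      where
      Φ : List (Fin N) → Carrier
      Φ hist = excess hist + potential hist

-- Collision probabilities and heavy buckets

module HashCollisions {c ℓ₁ ℓ₂} (K : OrderedField c ℓ₁ ℓ₂) where
  open OrderedField K hiding (zero)
  open OrderedFieldProperties K
  open FiniteProbability K
  open ExpectationProperties K
  open Charges K
  open ErrorPotential K
  open Error K
  open PartialOrderReasoning poset
  open Sum semiring
    using (sum-cong-≋; ∑-distrib-+; ∑-comm; *-distribˡ-sum; *-distribʳ-sum; sum-replicate)
  open SemiringSolver commutativeSemiring using (solve; _:=_; _:+_; _:*_; con)

  sum-const : ∀ n x → sum {n} (λ _ → x) ≈ fromℕ n * x
  sum-const n x = trans (sum-replicate n)
    (trans (Mult.×-congʳ semiring n (sym (*-identityˡ x))) (sym (Mult.×-assoc-* semiring n 1# x)))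

  fromℕ-nonZero-pos : ∀ n .{{_ : NonZero n}} → 0# < fromℕ n
  fromℕ-nonZero-pos n = fromℕ-pos (ℕ.>-nonZero⁻¹ n)

  uniform-isDistribution : ∀ n .{{_ : NonZero n}} → IsDistribution (uniform n)
  uniform-isDistribution n = record
    { nonNeg   = λ _ → ⁻¹-nonNeg (fromℕ-nonZero-pos n)
    ; sumToOne = trans (sum-const n _) (⁻¹-inverseʳ (<⇒≉0 (fromℕ-nonZero-pos n)))
    }

  -- An inequality because `n` may be smaller than `k`.
  sum-𝟙-< : ∀ k n → sum {n} (λ l → 𝟙 (not (does (k ℕ.≤? toℕ l)))) ≤ fromℕ k
  sum-𝟙-< k       zero    = fromℕ-nonNeg k
  sum-𝟙-< zero    (suc n) = ≤-reflexive (Sum.sum-replicate-zero semiring (suc n))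
  sum-𝟙-< (suc k) (suc n) = +-monoʳ-≤ 1# (begin
    sum {n} (λ l → 𝟙 (not (does (suc k ℕ.≤? suc (toℕ l)))))
      ≈⟨ sum-cong-≋ {n} (λ l → reflexive (≡.cong (𝟙 ∘ not)
           (does-⇔ (mk⇔ ℕ.s≤s⁻¹ s≤s) (suc k ℕ.≤? suc (toℕ l)) (k ℕ.≤? toℕ l)))) ⟩
    sum {n} (λ l → 𝟙 (not (does (k ℕ.≤? toℕ l))))
      ≤⟨ sum-𝟙-< k n ⟩
    fromℕ k ∎)

  module ErrorRate {M N w : ℕ} .{{_ : NonZero M}} .{{_ : NonZero w}}
    (H : Fin M → Fin N → Fin w) (pairwise : PairwiseIndependent H)
    {p : Fin N → Carrier} (dist : IsDistribution p) (i : Fin N) where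
    open IsDistribution dist

    module U = IsDistribution (uniform-isDistribution M)

    collide : Fin N → Fin N → Fin M → Bool
    collide i j m = does (H m i Fin.≟ H m j)

    𝟙-≟-∧ : ∀ (x y a : Fin w) →
      𝟙 (does (x Fin.≟ a) ∧ does (y Fin.≟ a)) ≈ 𝟙 (does (a Fin.≟ x)) * 𝟙 (does (y Fin.≟ a))
    𝟙-≟-∧ x y a with x Fin.≟ a | a Fin.≟ x
    ... | yes _ | yes _ = sym (*-identityˡ _)
    ... | no _  | no _  = sym (zeroˡ _)
    ... | yes x≡a | no a≢x = contradiction (≡.sym x≡a) a≢x
    ... | no x≢a | yes a≡x = contradiction (≡.sym a≡x) x≢a

    -- A collision is split by the common hash value: w values, each of probability 1/w².
    Pr-collide : ∀ i j → i ≢ j → sum (λ m → uniform M m * 𝟙 (collide i j m)) ≈ fromℕ w ⁻¹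
    Pr-collide i j i≢j = begin-equality
      sum (λ m → u * 𝟙 (does (H m i Fin.≟ H m j)))
        ≡⟨ Sum.sum-cong-≗ semiring (λ m → ≡.cong (λ b → u * 𝟙 b)
             (does-⇔ (mk⇔ ≡.sym ≡.sym) (H m i Fin.≟ H m j) (H m j Fin.≟ H m i))) ⟩
      sum (λ m → u * 𝟙 (does (H m j Fin.≟ H m i)))
        ≈⟨ sum-cong-≋ (λ m → *-congˡ (sum-if-≟ (λ a → 𝟙 (does (H m j Fin.≟ a))) (H m i))) ⟨
      sum (λ m → u * sum (λ a → 𝟙 (does (a Fin.≟ H m i)) * 𝟙 (does (H m j Fin.≟ a))))
        ≈⟨ sum-cong-≋ (λ m → *-congˡ (sum-cong-≋ λ a → 𝟙-≟-∧ (H m i) (H m j) a)) ⟨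
      sum (λ m → u * sum (λ a → 𝟙 (both m a)))
        ≈⟨ sum-cong-≋ (λ m → *-distribˡ-sum u (λ a → 𝟙 (both m a))) ⟩
      sum (λ m → sum (λ a → u * 𝟙 (both m a)))
        ≈⟨ ∑-comm (λ m a → u * 𝟙 (both m a)) ⟩
      sum (λ a → sum (λ m → u * 𝟙 (both m a)))
        ≈⟨ sum-cong-≋ (λ a → sum-cong-≋ λ m → trans (if≈𝟙* (both m a) u) (*-comm _ u)) ⟨
      sum (λ a → sum (λ m → if both m a then u else 0#))
        ≈⟨ sum-cong-≋ (λ a → pairwise i j i≢j a a) ⟩
      sum {w} (λ _ → fromℕ w ⁻¹ * fromℕ w ⁻¹)
        ≈⟨ sum-const w _ ⟩
      fromℕ w * (fromℕ w ⁻¹ * fromℕ w ⁻¹)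
        ≈⟨ *-assoc _ _ _ ⟨
      fromℕ w * fromℕ w ⁻¹ * fromℕ w ⁻¹
        ≈⟨ *-congʳ (⁻¹-inverseʳ (<⇒≉0 (fromℕ-nonZero-pos w))) ⟩
      1# * fromℕ w ⁻¹
        ≈⟨ *-identityˡ _ ⟩
      fromℕ w ⁻¹ ∎
      where
      u : Carrier
      u = fromℕ M ⁻¹

      both : Fin M → Fin w → Bool
      both m a = does (H m i Fin.≟ a) ∧ does (H m j Fin.≟ a)

    bucketMass : Fin N → Fin M → Carrier
    bucketMass j m = sum (λ l → 𝟙 (collide j l m) * p l)

    heavy : Fin N → Fin M → Carrier
    heavy j m = 𝟙 (does (p i ≤? bucketMass j m))

    heavy-nonNeg : ∀ j m → 0# ≤ heavy j m
    heavy-nonNeg j m = 𝟙-nonNeg (does (p i ≤? bucketMass j m))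

    Pr-heavy : Fin N → Carrier
    Pr-heavy j = sum (λ m → uniform M m * heavy j m)

    Pr-heavy-nonNeg : ∀ j → 0# ≤ Pr-heavy j
    Pr-heavy-nonNeg j = sum-nonNeg λ m → *-nonNeg (U.nonNeg m) (heavy-nonNeg j m)

    Pr-heavy≤1 : ∀ j → Pr-heavy j ≤ 1#
    Pr-heavy≤1 j = begin
      sum (λ m → uniform M m * heavy j m)
        ≤⟨ sum-mono-≤ (λ m → *-monoˡ-≤ (U.nonNeg m) (𝟙≤1 (does (p i ≤? bucketMass j m)))) ⟩
      sum (λ m → uniform M m * 1#)
        ≈⟨ mean-const (uniform-isDistribution M) 1# ⟩
      1# ∎

    -- A bucket of j that is at least as heavy as i contains another item
    -- before k or mass at least x = p i − p j from other items from k on: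
    -- union bound for the former, Markov's inequality for the latter.
    module Markov (j : Fin N) (k : ℕ) (0<x : 0# < p i - p j) where

      x : Carrier
      x = p i - p j

      -- Weights for which the items other than j in a heavy bucket total at least 1: one early item
      -- suffices by itself, late items count in proportion to their mass.
      cost : Fin N → Carrier
      cost l = if does (k ℕ.≤? toℕ l) then p l * x ⁻¹ else 1#

      cost-nonNeg : ∀ l → 0# ≤ cost l
      cost-nonNeg l with does (k ℕ.≤? toℕ l)
      ... | true  = *-nonNeg (nonNeg l) (⁻¹-nonNeg 0<x)
      ... | false = 0≤1

      cost-early : ∀ l → ¬ k ℕ.≤ toℕ l → cost l ≡ 1#
      cost-early l k≰l = ≡.cong (if_then p l * x ⁻¹ else 1#) (dec-false (k ℕ.≤? toℕ l) k≰l)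

      cost-late : ∀ l → k ℕ.≤ toℕ l → cost l ≡ p l * x ⁻¹
      cost-late l k≤l = ≡.cong (if_then p l * x ⁻¹ else 1#) (dec-true (k ℕ.≤? toℕ l) k≤l)

      other : Fin N → Carrier
      other l = 𝟙 (not (does (l Fin.≟ j)))

      term : Fin M → Fin N → Carrier
      term m l = other l * (𝟙 (collide j l m) * cost l)

      term-nonNeg : ∀ m l → 0# ≤ term m l
      term-nonNeg m l = *-nonNeg (𝟙-nonNeg (not (does (l Fin.≟ j))))
        (*-nonNeg (𝟙-nonNeg (collide j l m)) (cost-nonNeg l))

      -- A colliding early item contributes a whole unit. If there is none, removing p j from the
      -- mass of the bucket leaves at least `x`, all of it from late items, whose terms are their
      -- masses divided by `x`.
      heavy≤sum-term : ∀ m → heavy j m ≤ sum (term m)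
      heavy≤sum-term m with p i ≤? bucketMass j m
      ... | no _ = sum-nonNeg (term-nonNeg m)
      ... | yes pᵢ≤ with Fin.any? (λ l →
              ¬? (l Fin.≟ j) ×-dec ((H m j Fin.≟ H m l) ×-dec ¬? (k ℕ.≤? toℕ l)))
      ...   | yes (l , l≢j , coll , k≰l) = ≤-trans 1≤term (term≤sum (term-nonNeg m) l)
        where
        1≤term : 1# ≤ term m l
        1≤term with l Fin.≟ j | H m j Fin.≟ H m l
        ... | yes l≡j | _       = contradiction l≡j l≢j
        ... | no _ | no ¬coll   = contradiction coll ¬coll
        ... | no _ | yes _      = ≤-reflexive (sym (trans (*-identityˡ _)
              (trans (*-identityˡ _) (reflexive (cost-early l k≰l)))))
      ...   | no none = *-cancelˡ-≤ 0<x (begin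
        x * 1#                  ≈⟨ *-identityʳ x ⟩
        p i - p j               ≤⟨ x≤z+y⇒x-y≤z (begin
          p i                     ≤⟨ pᵢ≤ ⟩
          bucketMass j m          ≤⟨ sum-mono-≤ pointwise ⟩
          sum (λ l → 𝟙 (does (l Fin.≟ j)) * p l + term m l * x)
            ≈⟨ ∑-distrib-+ (λ l → 𝟙 (does (l Fin.≟ j)) * p l) (λ l → term m l * x) ⟩
          sum (λ l → 𝟙 (does (l Fin.≟ j)) * p l) + sum (λ l → term m l * x)
            ≈⟨ +-cong (sum-if-≟ p j) (sym (*-distribʳ-sum x (term m))) ⟩
          p j + sum (term m) * x  ≈⟨ +-comm _ _ ⟩
          sum (term m) * x + p j  ∎) ⟩
        sum (term m) * x        ≈⟨ *-comm _ x ⟩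
        x * sum (term m)        ∎)
        where
        pointwise : ∀ l → 𝟙 (collide j l m) * p l ≤ 𝟙 (does (l Fin.≟ j)) * p l + term m l * x
        pointwise l with l Fin.≟ j | H m j Fin.≟ H m l | k ℕ.≤? toℕ l | none ∘ (l ,_)
        ... | yes _ | c | _ | _ = begin
          𝟙 (does c) * p l ≤⟨ *-monoʳ-≤ (nonNeg l) (𝟙≤1 (does c)) ⟩
          1# * p l         ≤⟨ x≤x+y _ (*-nonNeg (≤-reflexive (sym (zeroˡ _))) (proj₁ 0<x)) ⟩
          1# * p l + _ * x ∎
        ... | no _ | no _ | _ | _ = ≤-reflexive
          (solve 3 (λ y a x → con 0 :* y := con 0 :* y :+ con 1 :* (con 0 :* a) :* x) refl (p l) _ x)
        ... | no _ | yes _ | yes k≤l | _ rewrite cost-late l k≤l = ≤-reflexive (begin-equality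
          1# * p l                ≈⟨ *-congˡ (trans (*-congˡ (⁻¹-inverseˡ 0<x)) (*-identityʳ (p l))) ⟨
          1# * (p l * (x ⁻¹ * x))
            ≈⟨ solve 3 (λ y z x → con 1 :* (y :* (z :* x)) :=
                 con 0 :* y :+ con 1 :* (con 1 :* (y :* z)) :* x) refl (p l) (x ⁻¹) x ⟩
          0# * p l + 1# * (1# * (p l * x ⁻¹)) * x ∎)
        ... | no l≢j | yes coll | no k≰l | ¬bad = contradiction (l≢j , coll , k≰l) ¬bad

      mass : Carrier
      mass = sumOver (λ l → k ℕ.≤? toℕ l) p

      sum-cost : sum cost ≤ mass * x ⁻¹ + fromℕ k
      sum-cost = begin
        sum cost
          ≈⟨ sum-cong-≋ split ⟩
        sum (λ l → (if does (k ℕ.≤? toℕ l) then p l else 0#) * x ⁻¹ + 𝟙 (not (does (k ℕ.≤? toℕ l))))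
          ≈⟨ ∑-distrib-+ (λ l → (if does (k ℕ.≤? toℕ l) then p l else 0#) * x ⁻¹) _ ⟩
        sum (λ l → (if does (k ℕ.≤? toℕ l) then p l else 0#) * x ⁻¹)
          + sum {N} (λ l → 𝟙 (not (does (k ℕ.≤? toℕ l))))
          ≤⟨ +-mono-≤
               (≤-reflexive (sym (*-distribʳ-sum (x ⁻¹) (λ l → if does (k ℕ.≤? toℕ l) then p l else 0#))))
               (sum-𝟙-< k N) ⟩
        mass * x ⁻¹ + fromℕ k ∎
        where
        split : ∀ l → cost l ≈ (if does (k ℕ.≤? toℕ l) then p l else 0#) * x ⁻¹
                                 + 𝟙 (not (does (k ℕ.≤? toℕ l)))
        split l with does (k ℕ.≤? toℕ l)
        ... | true  = sym (+-identityʳ _)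
        ... | false = sym (trans (+-congʳ (zeroˡ _)) (+-identityˡ 1#))

      mean-term : ∀ l → sum (λ m → uniform M m * term m l) ≤ cost l * fromℕ w ⁻¹
      mean-term l with l Fin.≟ j
      ... | yes _  = begin
        sum (λ m → uniform M m * (0# * (𝟙 (collide j l m) * cost l)))
          ≈⟨ sum-cong-≋ (λ m → trans (*-congˡ (zeroˡ _)) (zeroʳ (uniform M m))) ⟩
        sum {M} (λ _ → 0#) ≈⟨ Sum.sum-replicate-zero semiring M ⟩
        0#                 ≤⟨ *-nonNeg (cost-nonNeg l) (⁻¹-nonNeg (fromℕ-nonZero-pos w)) ⟩
        cost l * fromℕ w ⁻¹ ∎
      ... | no l≢j = ≤-reflexive (begin-equality
        sum (λ m → uniform M m * (1# * (𝟙 (collide j l m) * cost l)))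
          ≈⟨ sum-cong-≋ (λ m → solve 3 (λ u c a → u :* (con 1 :* (c :* a)) := u :* c :* a) refl
               (uniform M m) (𝟙 (collide j l m)) (cost l)) ⟩
        sum (λ m → uniform M m * 𝟙 (collide j l m) * cost l)
          ≈⟨ *-distribʳ-sum (cost l) (λ m → uniform M m * 𝟙 (collide j l m)) ⟨
        sum (λ m → uniform M m * 𝟙 (collide j l m)) * cost l
          ≈⟨ *-congʳ (Pr-collide j l (l≢j ∘ ≡.sym)) ⟩
        fromℕ w ⁻¹ * cost l
          ≈⟨ *-comm _ _ ⟩
        cost l * fromℕ w ⁻¹ ∎)

      Pr-heavy≤cost : Pr-heavy j ≤ (mass * x ⁻¹ + fromℕ k) * fromℕ w ⁻¹
      Pr-heavy≤cost = begin
        sum (λ m → uniform M m * heavy j m)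
          ≤⟨ sum-mono-≤ (λ m → *-monoˡ-≤ (U.nonNeg m) (heavy≤sum-term m)) ⟩
        sum (λ m → uniform M m * sum (term m))
          ≈⟨ sum-cong-≋ (λ m → *-distribˡ-sum (uniform M m) (term m)) ⟩
        sum (λ m → sum (λ l → uniform M m * term m l))
          ≈⟨ ∑-comm (λ m l → uniform M m * term m l) ⟩
        sum (λ l → sum (λ m → uniform M m * term m l))
          ≤⟨ sum-mono-≤ mean-term ⟩
        sum (λ l → cost l * fromℕ w ⁻¹)
          ≈⟨ *-distribʳ-sum (fromℕ w ⁻¹) cost ⟨
        sum cost * fromℕ w ⁻¹
          ≤⟨ *-monoʳ-≤ (⁻¹-nonNeg (fromℕ-nonZero-pos w)) sum-cost ⟩
        (mass * x ⁻¹ + fromℕ k) * fromℕ w ⁻¹ ∎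

      mass-nonNeg : 0# ≤ mass
      mass-nonNeg = sum-nonNeg λ l → ≤-trans (*-nonNeg (𝟙-nonNeg (does (k ℕ.≤? toℕ l))) (nonNeg l))
        (≤-reflexive (sym (if≈𝟙* (does (k ℕ.≤? toℕ l)) (p l))))

      -- Markov's inequality yields the factor 1/(w x); the one in `𝒜` is 1/((w - k) x), which is at
      -- least as large. That k < w keeps it a genuine inverse.
      x⁻¹w⁻¹≤ : k ℕ.< w → x ⁻¹ * fromℕ w ⁻¹ ≤ (fromℕ (w ∸ k) * x) ⁻¹
      x⁻¹w⁻¹≤ k<w = *-cancelˡ-≤ 0<v*x (begin
        (v * x) * (x ⁻¹ * fromℕ w ⁻¹)
          ≈⟨ solve 4 (λ v x y z → (v :* x) :* (y :* z) := (y :* x) :* (v :* z)) refl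
               v x (x ⁻¹) (fromℕ w ⁻¹) ⟩
        (x ⁻¹ * x) * (v * fromℕ w ⁻¹)
          ≈⟨ trans (*-congʳ (⁻¹-inverseˡ 0<x)) (*-identityˡ _) ⟩
        v * fromℕ w ⁻¹
          ≤⟨ *-monoʳ-≤ (⁻¹-nonNeg (fromℕ-nonZero-pos w)) (fromℕ-mono-≤ (ℕ.m∸n≤m w k)) ⟩
        fromℕ w * fromℕ w ⁻¹
          ≈⟨ ⁻¹-inverseʳ (<⇒≉0 (fromℕ-nonZero-pos w)) ⟩
        1#
          ≈⟨ ⁻¹-inverseʳ (<⇒≉0 0<v*x) ⟨
        (v * x) * (v * x) ⁻¹ ∎)
        where
        v : Carrier
        v = fromℕ (w ∸ k)

        0<v*x : 0# < v * x
        0<v*x = *-pos (fromℕ-pos (ℕ.m<n⇒0<n∸m k<w)) 0<x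

      Pr-heavy≤ : k ℕ.< w → Pr-heavy j ≤ mass / (fromℕ (w ∸ k) * x) + fromℕ k / fromℕ w
      Pr-heavy≤ k<w = begin
        Pr-heavy j
          ≤⟨ Pr-heavy≤cost ⟩
        (mass * x ⁻¹ + fromℕ k) * fromℕ w ⁻¹
          ≈⟨ solve 4 (λ a y k z → (a :* y :+ k) :* z := a :* (y :* z) :+ k :* z) refl
               mass (x ⁻¹) (fromℕ k) (fromℕ w ⁻¹) ⟩
        mass * (x ⁻¹ * fromℕ w ⁻¹) + fromℕ k * fromℕ w ⁻¹
          ≤⟨ +-monoˡ-≤ _ (*-monoˡ-≤ mass-nonNeg (x⁻¹w⁻¹≤ k<w)) ⟩
        mass / (fromℕ (w ∸ k) * x) + fromℕ k / fromℕ w ∎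

    -- At equal probabilities `𝒜` is 1, the trivial bound. Otherwise the difference is positive, and
    -- each candidate k of the minimum is an admissible threshold.
    Pr-heavy≤𝒜 : ∀ d j → p j ≤ p i → Pr-heavy j ≤ 𝒜 d w p (p i - p j)
    Pr-heavy≤𝒜 d j pⱼ≤pᵢ = if-glb ((p i - p j) ≟ 0#)
      (λ _ → Pr-heavy≤1 j)
      (λ x≉0 → minimum-glb {_≤_ = _≤_} _⊓_ ⊓-glb _ λ k →
        Markov.Pr-heavy≤ j (toℕ k) (x≤y⇒0≤y-x pⱼ≤pᵢ , x≉0 ∘ sym) (Fin.toℕ<n k))

    Pr-heavy^≤γ : (∀ {i j} → i Fin.≤ j → p j ≤ p i) →
                  ∀ d j → Pr-heavy j ^ d ≤ γ (suc d) w p i j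
    Pr-heavy^≤γ sorted d j = if-glb (j Fin.≤? i)
      (λ _ → ^-≤1 d (Pr-heavy-nonNeg j) (Pr-heavy≤1 j))
      (λ j≰i → ⊓-glb
        -- The numbering by decreasing probability makes the argument of `𝒜` nonnegative for j > i.
        (^-monoˡ-≤ d (Pr-heavy-nonNeg j) (Pr-heavy≤𝒜 (suc d) j (sorted (ℕ.<⇒≤ (ℕ.≰⇒> j≰i)))))
        (^-≤1 d (Pr-heavy-nonNeg j) (Pr-heavy≤1 j)))

    -- Averaging over the independent rows

    ∏-heavy : Fin N → ∀ {d} → Vec (Fin M) d → Carrier
    ∏-heavy j = ∏ (heavy j)

    ∏-heavy-nonNeg : ∀ j {d} (ms : Vec (Fin M) d) → 0# ≤ ∏-heavy j ms
    ∏-heavy-nonNeg j []       = 0≤1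
    ∏-heavy-nonNeg j (m ∷ ms) = *-nonNeg (heavy-nonNeg j m) (∏-heavy-nonNeg j ms)

    -- The price is the indicator that every row is heavy. A heavy row contributes a factor 1 and is
    -- skipped; the first light row makes the product 0, and its negative drift provides a free
    -- charge.
    lightRowCharge : ∀ j {d} (ms : Vec (Fin M) d) → Charge p
      (λ hist → ∀ r → countᵇ (λ l → does (l Fin.≟ i)) hist
        ℕ.≤ countᵇ (λ l → collide j l (Vec.lookup ms r)) hist)
      (∏-heavy j ms)
    lightRowCharge j []       = unitCharge
    lightRowCharge j (m ∷ ms) with p i ≤? bucketMass j m
    ... | yes _   = mapCharge (λ _ → _∘ suc) (sym (*-identityˡ _)) (lightRowCharge j ms)
    ... | no q<pᵢ = mapCharge (λ _ n≤ → n≤ zero) (sym (zeroˡ _))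
                      (NegativeDrift.charge dist i (λ l → collide j l m) (≰⇒> q<pᵢ))

    module _ {d : ℕ} where

      rows : Vec (Fin M) (suc d) → Fin (suc d) → Fin N → Fin w
      rows ms r = H (Vec.lookup ms r)

      module RowBound (m : Fin M) (ms : Vec (Fin M) d) =
        Bound dist i (rows (m ∷ ms)) (λ j → ∏-heavy j ms) (λ j → ∏-heavy-nonNeg j ms)
          (λ j → lightRowCharge j ms)

      initialPotential meanRate : Vec (Fin M) (suc d) → Carrier
      initialPotential (m ∷ ms) = RowBound.potential m ms []
      meanRate         (m ∷ ms) = RowBound.rate m ms

      initialPotential-nonNeg : ∀ ms → 0# ≤ initialPotential ms
      initialPotential-nonNeg (m ∷ ms) = RowBound.potential-nonNeg m ms []

      errorRate-≤ : ∀ {t} → 1 ℕ.≤ t → ∀ ms →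
        𝔼-iid p t (λ z → error (rows ms) z i / fromℕ t)
          ≤ meanRate ms + initialPotential ms * fromℕ t ⁻¹
      errorRate-≤ {t} 1≤t (m ∷ ms) = begin
        𝔼-iid p t (λ z → error (rows (m ∷ ms)) z i / fromℕ t)
          ≈⟨ 𝔼-*ʳ p t (λ z → error (rows (m ∷ ms)) z i) (fromℕ t ⁻¹) ⟩
        𝔼-iid p t (λ z → error (rows (m ∷ ms)) z i) * fromℕ t ⁻¹
          ≤⟨ *-monoʳ-≤ (⁻¹-nonNeg 0<t) (RowBound.𝔼-error-≤ m ms t) ⟩
        (b + fromℕ t * g) * fromℕ t ⁻¹
          ≈⟨ solve 4 (λ b t g t⁻¹ → (b :+ t :* g) :* t⁻¹ := g :* (t :* t⁻¹) :+ b :* t⁻¹) refl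
               b (fromℕ t) g (fromℕ t ⁻¹) ⟩
        g * (fromℕ t * fromℕ t ⁻¹) + b * fromℕ t ⁻¹
          ≈⟨ +-congʳ (trans (*-congˡ (⁻¹-inverseʳ (<⇒≉0 0<t))) (*-identityʳ g)) ⟩
        g + b * fromℕ t ⁻¹ ∎
        where
        b g : Carrier
        b = initialPotential (m ∷ ms)
        g = meanRate (m ∷ ms)

        0<t : 0# < fromℕ t
        0<t = fromℕ-pos 1≤t

      other : Fin N → Carrier
      other l = 𝟙 (not (does (l Fin.≟ i)))

      -- Allows `𝔼-rateTerm`, which holds only for l ≢ i, to be used inside a sum over all l.
      other-cong : ∀ l {x y} → (l ≢ i → x ≈ y) → other l * x ≈ other l * y
      other-cong l x≈y with l Fin.≟ i
      ... | yes _   = trans (zeroˡ _) (sym (zeroˡ _))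
      ... | no l≢i  = *-congˡ (x≈y l≢i)

      rateTerm : Fin N → Vec (Fin M) (suc d) → Carrier
      rateTerm l ms = 𝟙 (collide i l (Vec.head ms)) * ∏-heavy l (Vec.tail ms)

      -- The collision depends on the head and the heaviness on the tail, so the expectation
      -- factors; the tail itself factors row by row through `𝔼-∏`.
      𝔼-rateTerm : ∀ l → l ≢ i →
        𝔼-iid (uniform M) (suc d) (rateTerm l) ≈ fromℕ w ⁻¹ * Pr-heavy l ^ d
      𝔼-rateTerm l l≢i = begin-equality
        sum (λ m → uniform M m * 𝔼-iid (uniform M) d (λ ms → 𝟙 (collide i l m) * ∏-heavy l ms))
          ≈⟨ sum-cong-≋ (λ m → trans
               (*-congˡ (trans (𝔼-*ˡ (uniform M) d _ (∏-heavy l))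
                               (*-congˡ (𝔼-∏ (uniform M) d (heavy l)))))
               (sym (*-assoc (uniform M m) _ _))) ⟩
        sum (λ m → uniform M m * 𝟙 (collide i l m) * Pr-heavy l ^ d)
          ≈⟨ *-distribʳ-sum (Pr-heavy l ^ d) (λ m → uniform M m * 𝟙 (collide i l m)) ⟨
        sum (λ m → uniform M m * 𝟙 (collide i l m)) * Pr-heavy l ^ d
          ≈⟨ *-congʳ (Pr-collide i l (l≢i ∘ ≡.sym)) ⟩
        fromℕ w ⁻¹ * Pr-heavy l ^ d ∎

      𝔼-rate≤errorBound : (∀ {i j} → i Fin.≤ j → p j ≤ p i) →
        𝔼-iid (uniform M) (suc d) meanRate ≤ errorBound (suc d) w p i
      𝔼-rate≤errorBound sorted = begin
        𝔼-iid (uniform M) (suc d) meanRate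
          ≈⟨ 𝔼-cong (uniform M) (suc d) {meanRate} {λ ms → sum (λ l → X l ms)}
               -- `meanRate` is defined by matching on the vector, so both sides agree by
               -- computation once it is split.
               (λ { (m ∷ ms) → refl }) ⟩
        𝔼-iid (uniform M) (suc d) (λ ms → sum (λ l → X l ms))
          ≈⟨ 𝔼-sum (uniform M) (suc d) X ⟩
        sum (λ l → 𝔼-iid (uniform M) (suc d) (X l))
          ≈⟨ sum-cong-≋ (λ l → trans
               (𝔼-*ˡ (uniform M) (suc d) (p l) (λ ms → other l * rateTerm l ms))
               (*-congˡ (trans (𝔼-*ˡ (uniform M) (suc d) (other l) (rateTerm l))
                               (other-cong l (𝔼-rateTerm l))))) ⟩
        sum (λ l → p l * (other l * (fromℕ w ⁻¹ * Pr-heavy l ^ d)))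
          ≤⟨ sum-mono-≤ term≤ ⟩
        sum (λ l → fromℕ w ⁻¹ * (if not (does (l Fin.≟ i)) then p l * γ (suc d) w p i l else 0#))
          ≈⟨ *-distribˡ-sum (fromℕ w ⁻¹)
               (λ l → if not (does (l Fin.≟ i)) then p l * γ (suc d) w p i l else 0#) ⟨
        errorBound (suc d) w p i ∎
        where
        X : Fin N → Vec (Fin M) (suc d) → Carrier
        X l ms = p l * (other l * rateTerm l ms)

        term≤ : ∀ l → p l * (other l * (fromℕ w ⁻¹ * Pr-heavy l ^ d))
          ≤ fromℕ w ⁻¹ * (if not (does (l Fin.≟ i)) then p l * γ (suc d) w p i l else 0#)
        term≤ l = begin
          p l * (other l * (w⁻¹ * Pr-heavy l ^ d))
            ≈⟨ solve 4 (λ p o w a → p :* (o :* (w :* a)) := w :* (o :* (p :* a))) refl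
                 (p l) (other l) w⁻¹ _ ⟩
          w⁻¹ * (other l * (p l * Pr-heavy l ^ d))
            ≤⟨ *-monoˡ-≤ (⁻¹-nonNeg (fromℕ-nonZero-pos w))
                 (*-monoˡ-≤ (𝟙-nonNeg (not (does (l Fin.≟ i))))
                   (*-monoˡ-≤ (nonNeg l) (Pr-heavy^≤γ sorted d l))) ⟩
          w⁻¹ * (other l * (p l * γ (suc d) w p i l))
            ≈⟨ *-congˡ (if≈𝟙* (not (does (l Fin.≟ i))) _) ⟨
          w⁻¹ * (if not (does (l Fin.≟ i)) then p l * γ (suc d) w p i l else 0#) ∎
          where
          w⁻¹ : Carrier
          w⁻¹ = fromℕ w ⁻¹

-- The constant and the final estimate

theorem1 : ∀ {c ℓ₁ ℓ₂} (K : OrderedField c ℓ₁ ℓ₂) →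
    let open OrderedField K
        open FiniteProbability K
        open Error K
    in
    (d w N M : ℕ) .{{_ : NonZero d}} .{{_ : NonZero w}} .{{_ : NonZero M}} →
    (p : Fin N → Carrier) → IsDistribution p →
    (∀ {i j} → i Fin.≤ j → p j ≤ p i) →
    (H : Fin M → Fin N → Fin w) → PairwiseIndependent H →
    (i : Fin N) →
    ∃[ B ] 0# ≤ B × (∀ t → 1 ℕ.≤ t →
      expectedErrorRate d H p i t ≤ errorBound d w p i + B / fromℕ t)
theorem1 K (suc d) w N M p dist sorted H pairwise i =
  B , 0≤B , bound
  where
  open OrderedField K hiding (zero)
  open OrderedFieldProperties K
  open FiniteProbability K
  open ExpectationProperties K
  open HashCollisions K
  open ErrorRate H pairwise dist i
  open Error K
  open PartialOrderReasoning poset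

  u : Fin M → Carrier
  u = uniform M

  0≤u : ∀ m → 0# ≤ u m
  0≤u = IsDistribution.nonNeg (uniform-isDistribution M)

  b₀ g : Vec (Fin M) (suc d) → Carrier
  b₀ = initialPotential
  g  = meanRate

  B : Carrier
  -- The initial potential averaged over the finitely many hash draws; the length of the stream does
  -- not enter.
  B = 𝔼-iid u (suc d) b₀

  0≤B : 0# ≤ B
  0≤B = begin
    0#                                    ≈⟨ zeroˡ _ ⟨
    0# * 𝔼-iid u (suc d) (λ _ → 0#)       ≈⟨ 𝔼-*ˡ u (suc d) 0# (λ _ → 0#) ⟨
    𝔼-iid u (suc d) (λ _ → 0# * 0#)       ≤⟨ 𝔼-mono-≤ u 0≤u (suc d) (λ ms →
      ≤-trans (≤-reflexive (zeroˡ 0#)) (initialPotential-nonNeg ms)) ⟩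
    B                                     ∎

  bound : ∀ t → 1 ℕ.≤ t →
    expectedErrorRate (suc d) H p i t ≤ errorBound (suc d) w p i + B / fromℕ t
  bound t 1≤t = begin
    expectedErrorRate (suc d) H p i t
      ≤⟨ 𝔼-mono-≤ u 0≤u (suc d) (errorRate-≤ 1≤t) ⟩
    𝔼-iid u (suc d) (λ ms → g ms + b₀ ms * fromℕ t ⁻¹)
      ≈⟨ trans (𝔼-+ u (suc d) g (λ ms → b₀ ms * fromℕ t ⁻¹))
               (+-congˡ (𝔼-*ʳ u (suc d) b₀ (fromℕ t ⁻¹))) ⟩
    𝔼-iid u (suc d) g + B / fromℕ t
      ≤⟨ +-monoˡ-≤ (B / fromℕ t) (𝔼-rate≤errorBound {d = d} sorted) ⟩
    errorBound (suc d) w p i + B / fromℕ t ∎
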